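{- For every $n\in\mathbb{N}$, the average resistance $M_n$ of all $n$-circuits lies between $1$ and $4.3954$: $$1\le M_n<4.3954 .$$
   Context: $\mathbb{N}=\{1,2,3,\dots\}$. Circuits are defined recursively and represented by ordered pairs of multisets. The unit circuit $(\{\},\{\})$ is a single unit resistor; it is considered to be both a series and a parallel circuit. A (non-unit) series circuit is a pair $(\{\alpha_1,\dots,\alpha_m\},\{\})$ where $\{\alpha_1,\dots,\alpha_m\}$ is a finite multiset of $m\ge 2$ parallel circuits (the unit circuit being allowed). A (non-unit) parallel circuit is a pair $(\{\},\{\beta_1,\dots,\beta_m\})$ where $\{\beta_1,\dots,\beta_m\}$ is a finite multiset of $m\ge 2$ series circuits (the unit circuit being allowed). Two circuits are the same iff these representations are equal. An $n$-circuit is a circuit containing exactly $n$ unit resistors (the unit circuit contains one; otherwise add the numbers in the sub-circuits). The resistance $r$ is defined by $r=1$ for the unit circuit, $r=\sum_i r(\alpha_i)$ for a series circuit with sub-circuits $\alpha_i$, and $r=\left(\sum_i r(\beta_i)^{ -1}\right)^{ -1}$ for a parallel circuit with sub-circuits $\beta_i$. $\Gamma_n$ is the (finite) set of all $n$-circuits, $Q_n=|\Gamma_n|$, $R_n=\sum_{\gamma\in\Gamma_n} r(\gamma)$, and $M_n=R_n/Q_n$. -}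

module Defs where

open import Data.Integer using (+_)
open import Data.List using (List; []; _∷_; _++_; map; concatMap; filter; foldr; length; replicate; upTo)
open import Data.List.Properties using (map-id)
open import Data.List.Relation.Unary.All as All using (All; []; _∷_)
import Data.List.Relation.Unary.All.Properties as AllP
open import Data.List.Relation.Unary.AllPairs using (AllPairs; []; _∷_) renaming (map to map-pairs)
import Data.List.Relation.Unary.AllPairs.Properties as AllPairsP
open import Data.List.Relation.Unary.Any as Any using (Any; here; there)
import Data.List.Relation.Unary.Any.Properties as AnyP
import Data.List.Membership.Propositional as Prop
import Data.List.Membership.Propositional.Properties as PropP
open import Data.List.Relation.Binary.Pointwise.Base using (Pointwise; []; _∷_)
open import Data.List.Relation.Binary.Permutation.Homogeneous using (Permutation; refl; prep; swap; trans)
import Data.List.Relation.Binary.Permutation.Setoid as PermS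
import Data.List.Relation.Binary.Permutation.Setoid.Properties as PermSP
open import Data.Nat using (ℕ; zero; suc; _+_; _*_; _∸_; _≤_; _<_; _≤?_; NonZero; z≤n; s≤s)
open import Data.Nat.ListAction using (sum)
import Data.Nat.Properties as ℕP
open import Data.Product using (_×_; _,_; ∃; ∃₂; proj₁; proj₂)
open import Data.Rational as ℚ using (ℚ; 0ℚ; 1ℚ; 1/_; Positive; ≢-nonZero)
import Data.Rational.Properties as ℚP
open import Data.Sum using (inj₁; inj₂)
open import Function using (_∘_)
open import Level using (0ℓ)
open import Relation.Binary.Bundles using (Setoid)
open import Relation.Binary.PropositionalEquality as ≡ using (_≡_; _≢_; cong; cong₂; subst; subst₂)
open import Relation.Nullary using (¬_; yes; no; contradiction)

data Kind : Set where
  series parallel : Kind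

dual : Kind → Kind
dual series   = parallel
dual parallel = series

-- `join series αs` stands for the pair (αs , {}), `join parallel βs` for
-- ({} , βs) and `unit` for ({} , {}).  Not every term is a circuit (see `Is`),
-- and the lists are read as multisets (see `_≈_`).
data Circuit : Set where
  unit : Circuit
  join : Kind → List Circuit → Circuit

data Is : Kind → Circuit → Set where
  unit : ∀ {k} → Is k unit
  join : ∀ {k cs} → 2 ≤ length cs → All (Is (dual k)) cs → Is k (join k cs)

IsCircuit : Circuit → Set
IsCircuit c = ∃ λ k → Is k c

-- Equality of nested multisets: lists are compared up to reordering, and their
-- entries recursively up to `_≈_`.
infix 4 _≈_
data _≈_ : Circuit → Circuit → Set where
  unit : unit ≈ unit
  join : ∀ {k cs ds} → Permutation _≈_ cs ds → join k cs ≈ join k ds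

mutual
  size : Circuit → ℕ
  size unit        = 1
  size (join _ cs) = sum (sizes cs)

  sizes : List Circuit → List ℕ
  sizes []       = []
  sizes (c ∷ cs) = size c ∷ sizes cs

sumℚ : List ℚ → ℚ
sumℚ = foldr ℚ._+_ 0ℚ

-- Total inverse with 0ℚ ⁻¹ = 0ℚ.  The value at 0ℚ is never used on circuits:
-- their resistances are positive (`r-positive`).
infix 8 _⁻¹
_⁻¹ : ℚ → ℚ
p ⁻¹ with p ℚ.≟ 0ℚ
... | yes _  = 0ℚ
... | no p≢0 = (1/ p) {{≢-nonZero p≢0}}

mutual
  r : Circuit → ℚ
  r unit               = 1ℚ
  r (join series αs)   = sumℚ (resistances αs)
  r (join parallel βs) = sumℚ (map _⁻¹ (resistances βs)) ⁻¹

  resistances : List Circuit → List ℚ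
  resistances []       = []
  resistances (c ∷ cs) = r c ∷ resistances cs

-- One representative of each multiset of total size n with elements from cs:
-- choose the multiplicity k of each entry in turn.
multisets : List Circuit → ℕ → List (List Circuit)
multisets []       zero    = [] ∷ []
multisets []       (suc _) = []
multisets (c ∷ cs) n       =
  concatMap (λ k → map (replicate k c ++_) (multisets cs (n ∸ k * size c)))
            (filter (λ k → k * size c ≤? n) (upTo (suc n)))

-- `exactly k n` lists the circuits c with Is k c and n resistors, `atMost k n`
-- those with at most n.  A multiset of total size 2 + n whose elements have
-- size at most 1 + n has automatically at least two elements.
mutual
  exactly : Kind → ℕ → List Circuit
  exactly k zero          = []
  exactly k (suc zero)    = unit ∷ []
  exactly k (suc (suc n)) = map (join k) (multisets (atMost (dual k) (suc n)) (suc (suc n)))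

  atMost : Kind → ℕ → List Circuit
  atMost k zero    = []
  atMost k (suc n) = atMost k n ++ exactly k (suc n)

-- Γ n lists every n-circuit exactly once up to `_≈_`: see `Γ-sound`,
-- `Γ-complete` and `Γ-distinct`.  Circuits of both kinds are collected, the
-- unit circuit (which is of both kinds) only once.
Γ : ℕ → List Circuit
Γ zero            = []
Γ (suc zero)      = unit ∷ []
Γ n@(suc (suc _)) = exactly series n ++ exactly parallel n

Q : ℕ → ℕ
Q n = length (Γ n)

R : ℕ → ℚ
R n = sumℚ (map r (Γ n))

mutual
  ≈-refl : ∀ {c} → c ≈ c
  ≈-refl {unit}      = unit
  ≈-refl {join _ cs} = join (refl (≋-refl cs))

  ≋-refl : ∀ cs → Pointwise _≈_ cs cs
  ≋-refl []       = []
  ≋-refl (_ ∷ cs) = ≈-refl ∷ ≋-refl cs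

mutual
  ≈-sym : ∀ {c d} → c ≈ d → d ≈ c
  ≈-sym unit     = unit
  ≈-sym (join p) = join (↭-symm p)

  ↭-symm : ∀ {cs ds} → Permutation _≈_ cs ds → Permutation _≈_ ds cs
  ↭-symm (refl es)    = refl (≋-symm es)
  ↭-symm (prep e p)   = prep (≈-sym e) (↭-symm p)
  ↭-symm (swap e f p) = swap (≈-sym f) (≈-sym e) (↭-symm p)
  ↭-symm (trans p q)  = trans (↭-symm q) (↭-symm p)

  ≋-symm : ∀ {cs ds} → Pointwise _≈_ cs ds → Pointwise _≈_ ds cs
  ≋-symm []       = []
  ≋-symm (e ∷ es) = ≈-sym e ∷ ≋-symm es

≈-trans : ∀ {c d e} → c ≈ d → d ≈ e → c ≈ e
≈-trans unit     unit     = unit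
≈-trans (join p) (join q) = join (trans p q)

circuitSetoid : Setoid 0ℓ 0ℓ
circuitSetoid = record
  { Carrier       = Circuit
  ; _≈_           = _≈_
  ; isEquivalence = record { refl = ≈-refl ; sym = ≈-sym ; trans = ≈-trans }
  }

open PermS circuitSetoid public using (_↭_; ↭-refl; ↭-sym; ↭-trans; ↭-prep)
open import Data.List.Membership.Setoid circuitSetoid public using (_∈_)

mutual
  size-resp-≈ : ∀ {c d} → c ≈ d → size c ≡ size d
  size-resp-≈ unit     = ≡.refl
  size-resp-≈ (join p) = sizes-resp-↭ p

  sizes-resp-↭ : ∀ {cs ds} → Permutation _≈_ cs ds → sum (sizes cs) ≡ sum (sizes ds)
  sizes-resp-↭ (refl es)  = sizes-resp-≋ es
  sizes-resp-↭ (prep e p) = cong₂ _+_ (size-resp-≈ e) (sizes-resp-↭ p)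
  sizes-resp-↭ (swap {xs} {ys} {x} {y} {x′} {y′} e f p) = begin
    size x + (size y + sum (sizes xs))    ≡⟨ cong₂ _+_ (size-resp-≈ e) (cong₂ _+_ (size-resp-≈ f) (sizes-resp-↭ p)) ⟩
    size x′ + (size y′ + sum (sizes ys))  ≡⟨ ℕP.+-assoc (size x′) (size y′) _ ⟨
    (size x′ + size y′) + sum (sizes ys)  ≡⟨ cong (_+ sum (sizes ys)) (ℕP.+-comm (size x′) (size y′)) ⟩
    (size y′ + size x′) + sum (sizes ys)  ≡⟨ ℕP.+-assoc (size y′) (size x′) _ ⟩
    size y′ + (size x′ + sum (sizes ys))  ∎
    where open ≡.≡-Reasoning
  sizes-resp-↭ (trans p q) = ≡.trans (sizes-resp-↭ p) (sizes-resp-↭ q)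

  sizes-resp-≋ : ∀ {cs ds} → Pointwise _≈_ cs ds → sum (sizes cs) ≡ sum (sizes ds)
  sizes-resp-≋ []       = ≡.refl
  sizes-resp-≋ (e ∷ es) = cong₂ _+_ (size-resp-≈ e) (sizes-resp-≋ es)

mutual
  r-resp-≈ : ∀ {c d} → c ≈ d → r c ≡ r d
  r-resp-≈ unit                = ≡.refl
  r-resp-≈ (join {series} {cs} {ds} p) =
    subst₂ (λ ps qs → sumℚ ps ≡ sumℚ qs) (map-id (resistances cs)) (map-id (resistances ds))
      (resistances-resp-↭ (λ q → q) p)
  r-resp-≈ (join {parallel} p) = cong _⁻¹ (resistances-resp-↭ _⁻¹ p)

  resistances-resp-↭ : ∀ (f : ℚ → ℚ) {cs ds} → Permutation _≈_ cs ds →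
    sumℚ (map f (resistances cs)) ≡ sumℚ (map f (resistances ds))
  resistances-resp-↭ f (refl es)  = resistances-resp-≋ f es
  resistances-resp-↭ f (prep e p) = cong₂ (λ a → f a ℚ.+_) (r-resp-≈ e) (resistances-resp-↭ f p)
  resistances-resp-↭ f (swap {xs} {ys} {x} {y} {x′} {y′} e g p) = begin
    f (r x) ℚ.+ (f (r y) ℚ.+ Σ xs)    ≡⟨ cong₂ (λ a → f a ℚ.+_) (r-resp-≈ e) (cong₂ (λ a → f a ℚ.+_) (r-resp-≈ g) (resistances-resp-↭ f p)) ⟩
    f (r x′) ℚ.+ (f (r y′) ℚ.+ Σ ys)  ≡⟨ ℚP.+-assoc (f (r x′)) (f (r y′)) _ ⟨
    (f (r x′) ℚ.+ f (r y′)) ℚ.+ Σ ys  ≡⟨ cong (ℚ._+ Σ ys) (ℚP.+-comm (f (r x′)) (f (r y′))) ⟩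
    (f (r y′) ℚ.+ f (r x′)) ℚ.+ Σ ys  ≡⟨ ℚP.+-assoc (f (r y′)) (f (r x′)) _ ⟩
    f (r y′) ℚ.+ (f (r x′) ℚ.+ Σ ys)  ∎
    where
    open ≡.≡-Reasoning
    Σ : List Circuit → ℚ
    Σ cs = sumℚ (map f (resistances cs))
  resistances-resp-↭ f (trans p q) = ≡.trans (resistances-resp-↭ f p) (resistances-resp-↭ f q)

  resistances-resp-≋ : ∀ (f : ℚ → ℚ) {cs ds} → Pointwise _≈_ cs ds →
    sumℚ (map f (resistances cs)) ≡ sumℚ (map f (resistances ds))
  resistances-resp-≋ f []       = ≡.refl
  resistances-resp-≋ f (e ∷ es) = cong₂ (λ a → f a ℚ.+_) (r-resp-≈ e) (resistances-resp-≋ f es)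

⁻¹-inverseʳ : ∀ {p} → p ≢ 0ℚ → p ℚ.* p ⁻¹ ≡ 1ℚ
⁻¹-inverseʳ {p} p≢0 with p ℚ.≟ 0ℚ
... | yes p≡0 = contradiction p≡0 p≢0
... | no  p≢0 = ℚP.*-inverseʳ p {{≢-nonZero p≢0}}

⁻¹-positive : ∀ p → Positive p → Positive (p ⁻¹)
⁻¹-positive p p>0 with p ℚ.≟ 0ℚ
... | yes ≡.refl = p>0
... | no _       = ℚP.1/pos⇒pos p {{p>0}}

sumℚ-positive : ∀ {ps} → 1 ≤ length ps → All Positive ps → Positive (sumℚ ps)
sumℚ-positive {p ∷ []} _ (p>0 ∷ []) = subst Positive (≡.sym (ℚP.+-identityʳ p)) p>0
sumℚ-positive {p ∷ ps@(_ ∷ _)} _ (p>0 ∷ ps>0) =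
  ℚP.pos+pos⇒pos p {{p>0}} (sumℚ ps) {{sumℚ-positive {ps} (s≤s z≤n) ps>0}}

mutual
  r-positive : ∀ {k c} → Is k c → Positive (r c)
  r-positive unit = _
  r-positive (join {series} {αs@(_ ∷ _)} _ is) =
    sumℚ-positive {resistances αs} (s≤s z≤n) (resistances-positive is)
  r-positive (join {parallel} {βs@(_ ∷ _)} _ is) =
    ⁻¹-positive (sumℚ (map _⁻¹ (resistances βs)))
      (sumℚ-positive {map _⁻¹ (resistances βs)} (s≤s z≤n)
        (AllP.map⁺ (All.map (λ {p} → ⁻¹-positive p) (resistances-positive is))))

  resistances-positive : ∀ {k cs} → All (Is k) cs → All Positive (resistances cs)
  resistances-positive []       = []
  resistances-positive (i ∷ is) = r-positive i ∷ resistances-positive is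

total-++ : ∀ k c cs → sum (sizes (replicate k c ++ cs)) ≡ k * size c + sum (sizes cs)
total-++ zero    c cs = ≡.refl
total-++ (suc k) c cs = ≡.trans (cong (_+_ (size c)) (total-++ k c cs)) (≡.sym (ℕP.+-assoc (size c) _ _))

multisets-sound : ∀ {P : Circuit → Set} {cs} → All P cs → ∀ n →
  All (λ ds → All P ds × sum (sizes ds) ≡ n) (multisets cs n)
multisets-sound []              zero    = ([] , ≡.refl) ∷ []
multisets-sound []              (suc n) = []
multisets-sound {P} {c ∷ cs} (pc ∷ pcs) n =
  AllP.concat⁺ (AllP.map⁺ (All.map (λ {k} → pick k) (AllP.all-filter (λ k → k * size c ≤? n) (upTo (suc n)))))
  where
  pick : ∀ k → k * size c ≤ n →
    All (λ ds → All P ds × sum (sizes ds) ≡ n) (map (replicate k c ++_) (multisets cs (n ∸ k * size c)))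
  pick k k≤ = AllP.map⁺ (All.map (λ {ds} (pds , eq) →
    AllP.++⁺ (AllP.replicate⁺ k pc) pds ,
    ≡.trans (total-++ k c ds) (≡.trans (cong (_+_ (k * size c)) eq) (ℕP.m+[n∸m]≡n k≤)))
    (multisets-sound pcs (n ∸ k * size c)))

split : ∀ {c cs ds} → All (_∈ (c ∷ cs)) ds →
  ∃₂ λ k es → ds ↭ replicate k c ++ es × All (_∈ cs) es
split [] = 0 , [] , ↭-refl , []
split {c} (here d≈c ∷ ds∈) with split ds∈
... | k , es , p , es∈ = suc k , es , prep d≈c p , es∈
split {c} {ds = d ∷ _} (there d∈cs ∷ ds∈) with split ds∈
... | k , es , p , es∈ = k , d ∷ es ,
  ↭-trans (↭-prep d p) (↭-sym (PermSP.shift circuitSetoid ≈-refl (replicate k c) es)) , d∈cs ∷ es∈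

multisets-complete : ∀ {cs} → All (λ c → 1 ≤ size c) cs → ∀ {ds} → All (_∈ cs) ds →
  ∀ {n} → sum (sizes ds) ≡ n → Any (ds ↭_) (multisets cs n)
multisets-complete [] [] ≡.refl = here ↭-refl
multisets-complete {c ∷ cs} (1≤c ∷ 1≤cs) {ds} ds∈ {n} eq with split ds∈
... | k , es , p , es∈ =
  AnyP.concat⁺ (AnyP.map⁺ (Prop.lose k∈
    (AnyP.map⁺ (Any.map (λ es↭ → ↭-trans p (PermSP.++⁺ˡ circuitSetoid (replicate k c) es↭))
      (multisets-complete 1≤cs es∈ total-es)))))
  where
  total-ds : k * size c + sum (sizes es) ≡ n
  total-ds = ≡.trans (≡.sym (total-++ k c es)) (≡.trans (≡.sym (sizes-resp-↭ p)) eq)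
  total-es : sum (sizes es) ≡ n ∸ k * size c
  total-es = ≡.trans (≡.sym (ℕP.m+n∸m≡n (k * size c) _)) (cong (_∸ k * size c) total-ds)
  k*c≤n : k * size c ≤ n
  k*c≤n = subst (k * size c ≤_) total-ds (ℕP.m≤m+n _ _)
  k≤n : k ≤ n
  k≤n = ℕP.≤-trans (ℕP.≤-reflexive (≡.sym (ℕP.*-identityʳ k))) (ℕP.≤-trans (ℕP.*-monoʳ-≤ k 1≤c) k*c≤n)
  k∈ : k Prop.∈ filter (λ k → k * size c ≤? n) (upTo (suc n))
  k∈ = PropP.∈-filter⁺ (λ k → k * size c ≤? n) (PropP.∈-upTo⁺ (s≤s k≤n)) k*c≤n

replicate-cancel : ∀ {c} j k {ds es} → All (λ d → ¬ c ≈ d) ds → j < k →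
  ¬ (replicate j c ++ ds ↭ replicate k c ++ es)
replicate-cancel zero (suc k) c∉ds _ p =
  AllP.All¬⇒¬Any c∉ds (PermSP.∈-resp-↭ circuitSetoid (↭-sym p) (here ≈-refl))
replicate-cancel (suc j) (suc k) c∉ds (s≤s j<k) p =
  replicate-cancel j k c∉ds j<k (PermSP.drop-∷ circuitSetoid p)

drop-replicate : ∀ {c} k {ds es} → replicate k c ++ ds ↭ replicate k c ++ es → ds ↭ es
drop-replicate zero    p = p
drop-replicate (suc k) p = drop-replicate k (PermSP.drop-∷ circuitSetoid p)

multisets-distinct : ∀ {cs} → AllPairs (λ c d → ¬ c ≈ d) cs → ∀ n →
  AllPairs (λ ds es → ¬ (ds ↭ es)) (multisets cs n)
multisets-distinct [] zero    = [] ∷ []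
multisets-distinct [] (suc n) = []
multisets-distinct {c ∷ cs} (c∉cs ∷ cs!) n =
  AllPairsP.concat⁺
    (AllP.map⁺ (All.universal
      (λ k → AllPairsP.map⁺ (map-pairs (λ ¬p p → ¬p (drop-replicate k p)) (multisets-distinct cs! (n ∸ k * size c)))) ks))
    (AllPairsP.map⁺ (AllPairsP.filter⁺ (λ k → k * size c ≤? n)
      (AllPairsP.applyUpTo⁺₁ (λ k → k) (suc n) λ {j} {k} j<k _ →
        AllP.map⁺ (All.map (λ {ds} (c∉ds , _) → AllP.map⁺ (All.universal (λ es → replicate-cancel j k c∉ds j<k) _))
          (multisets-sound c∉cs (n ∸ j * size c))))))
  where
  ks = filter (λ k → k * size c ≤? n) (upTo (suc n))

1≤size : ∀ {k c} → Is k c → 1 ≤ size c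
1≤size unit                   = s≤s z≤n
1≤size (join (s≤s _) (i ∷ _)) = ℕP.≤-trans (1≤size i) (ℕP.m≤m+n _ _)

size≤total : ∀ cs → All (λ c → size c ≤ sum (sizes cs)) cs
size≤total []       = []
size≤total (c ∷ cs) =
  ℕP.m≤m+n _ _ ∷ All.map (λ le → ℕP.≤-trans le (ℕP.m≤n+m _ (size c))) (size≤total cs)

size<total : ∀ {cs} → 2 ≤ length cs → All (λ c → 1 ≤ size c) cs → All (λ c → size c < sum (sizes cs)) cs
size<total {c ∷ d ∷ cs} _ (1≤c ∷ 1≤d ∷ _) =
  subst (_≤ size c + total) (ℕP.+-comm (size c) 1)
    (ℕP.+-monoʳ-≤ (size c) (ℕP.≤-trans 1≤d (ℕP.m≤m+n _ _))) ∷
  All.map (λ le → ℕP.≤-trans (s≤s le) (ℕP.+-monoˡ-≤ total 1≤c)) (size≤total (d ∷ cs))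
  where total = sum (sizes (d ∷ cs))
size<total {_ ∷ []} (s≤s ())

2≤length : ∀ {n} cs → All (λ c → size c ≤ suc n) cs → sum (sizes cs) ≡ suc (suc n) → 2 ≤ length cs
2≤length []           _          ()
2≤length (c ∷ [])     (le ∷ [])  eq =
  contradiction (subst (_≤ _) (≡.trans (≡.sym (ℕP.+-identityʳ (size c))) eq) le) ℕP.1+n≰n
2≤length (_ ∷ _ ∷ _)  _          _  = s≤s (s≤s z≤n)

mutual
  exactly-sound : ∀ k n → All (λ c → Is k c × size c ≡ n) (exactly k n)
  exactly-sound k zero          = []
  exactly-sound k (suc zero)    = (unit , ≡.refl) ∷ []
  exactly-sound k (suc (suc n)) = AllP.map⁺ (All.map
    (λ {cs} (ps , eq) → join (2≤length cs (All.map proj₂ ps) eq) (All.map proj₁ ps) , eq)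
    (multisets-sound (atMost-sound (dual k) (suc n)) (suc (suc n))))

  atMost-sound : ∀ k n → All (λ c → Is k c × size c ≤ n) (atMost k n)
  atMost-sound k zero    = []
  atMost-sound k (suc n) = AllP.++⁺
    (All.map (λ (i , le) → i , ℕP.m≤n⇒m≤1+n le) (atMost-sound k n))
    (All.map (λ (i , eq) → i , ℕP.≤-reflexive eq) (exactly-sound k (suc n)))

atMost-∈ : ∀ {k c m} n → m ≤ n → c ∈ exactly k m → c ∈ atMost k n
atMost-∈ {m = zero} zero _ ()
atMost-∈ {k} (suc n) m≤1+n c∈ with ℕP.m≤n⇒m<n∨m≡n m≤1+n
... | inj₁ (s≤s m≤n) = AnyP.++⁺ˡ (atMost-∈ n m≤n c∈)
... | inj₂ ≡.refl    = AnyP.++⁺ʳ (atMost k n) c∈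

mutual
  exactly-complete : ∀ {k c} → Is k c → ∀ {n} → size c ≡ n → c ∈ exactly k n
  exactly-complete unit ≡.refl = here ≈-refl
  exactly-complete {k} (join {cs = cs} 2≤ is) {n} eq = finish n eq
    where
    smaller : All (λ c → size c < sum (sizes cs)) cs
    smaller = size<total 2≤ (All.map 1≤size is)
    finish : ∀ n → sum (sizes cs) ≡ n → join k cs ∈ exactly k n
    finish zero eq = contradiction eq (nonzero cs 2≤ smaller)
      where
      nonzero : ∀ ds {t} → 2 ≤ length ds → All (λ c → size c < t) ds → t ≢ 0
      nonzero (_ ∷ _) _ (() ∷ _) ≡.refl
    finish (suc zero) eq = contradiction eq (nonone cs 2≤ is smaller)
      where
      nonone : ∀ ds {t} → 2 ≤ length ds → All (Is (dual k)) ds → All (λ c → size c < t) ds → t ≢ 1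
      nonone (d ∷ _) _ (i ∷ _) (s≤s lt ∷ _) ≡.refl = ℕP.1+n≰n (ℕP.≤-trans (1≤size i) lt)
    finish (suc (suc n)) eq = AnyP.map⁺ (Any.map join
      (multisets-complete (All.map (1≤size ∘ proj₁) (atMost-sound (dual k) (suc n)))
        (All.zipWith (λ {c} (lt , c∈) → atMost-∈ (suc n) (ℕP.≤-pred (subst (size c <_) eq lt)) c∈)
          (smaller , all-complete is))
        eq))

  all-complete : ∀ {k cs} → All (Is k) cs → All (λ c → c ∈ exactly k (size c)) cs
  all-complete []       = []
  all-complete (i ∷ is) = exactly-complete i ≡.refl ∷ all-complete is

join-injective : ∀ {k cs ds} → join k cs ≈ join k ds → cs ↭ ds
join-injective (join p) = p

mutual
  exactly-distinct : ∀ k n → AllPairs (λ c d → ¬ c ≈ d) (exactly k n)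
  exactly-distinct k zero          = []
  exactly-distinct k (suc zero)    = [] ∷ []
  exactly-distinct k (suc (suc n)) = AllPairsP.map⁺ (map-pairs (λ ¬p → ¬p ∘ join-injective)
    (multisets-distinct (atMost-distinct (dual k) (suc n)) (suc (suc n))))

  atMost-distinct : ∀ k n → AllPairs (λ c d → ¬ c ≈ d) (atMost k n)
  atMost-distinct k zero    = []
  atMost-distinct k (suc n) = AllPairsP.++⁺ (atMost-distinct k n) (exactly-distinct k (suc n))
    (All.map (λ (_ , le) → All.map
      (λ (_ , eq) c≈d → ℕP.1+n≰n (subst (_≤ n) (≡.trans (size-resp-≈ c≈d) eq) le))
      (exactly-sound k (suc n))) (atMost-sound k n))

Γ-sound : ∀ n → All (λ c → IsCircuit c × size c ≡ n) (Γ n)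
Γ-sound zero            = []
Γ-sound (suc zero)      = ((series , unit) , ≡.refl) ∷ []
Γ-sound n@(suc (suc _)) = AllP.++⁺ (kind series) (kind parallel)
  where
  kind : ∀ k → All (λ c → IsCircuit c × size c ≡ n) (exactly k n)
  kind k = All.map (λ (i , eq) → (k , i) , eq) (exactly-sound k n)

Γ-complete : ∀ {c n} → IsCircuit c → size c ≡ n → c ∈ Γ n
Γ-complete {n = zero}          (k , i)        eq = exactly-complete i eq
Γ-complete {n = suc zero}      (k , i)        eq = exactly-complete i eq
Γ-complete {n = suc (suc _)}   (series , i)   eq = AnyP.++⁺ˡ (exactly-complete i eq)
Γ-complete {n = n@(suc (suc _))} (parallel , i) eq = AnyP.++⁺ʳ (exactly series n) (exactly-complete i eq)

Γ-distinct : ∀ n → AllPairs (λ c d → ¬ c ≈ d) (Γ n)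
Γ-distinct zero            = []
Γ-distinct (suc zero)      = [] ∷ []
Γ-distinct n@(suc (suc _)) = AllPairsP.++⁺ (exactly-distinct series n) (exactly-distinct parallel n)
  (All.map (λ (i , eq) → All.map (λ (j , _) → apart i j eq) (exactly-sound parallel n)) (exactly-sound series n))
  where
  apart : ∀ {c d m} → Is series c → Is parallel d → size c ≡ suc (suc m) → ¬ c ≈ d
  apart unit       _          () _
  apart (join _ _) (join _ _) _  ()

Q-nonZero : ∀ n → .{{NonZero n}} → NonZero (Q n)
Q-nonZero n = nonEmpty (some n)
  where
  units : ∀ m → sum (sizes (replicate m unit)) ≡ m
  units zero    = ≡.refl
  units (suc m) = cong suc (units m)
  some : ∀ n → .{{NonZero n}} → ∃ λ c → c ∈ Γ n
  some (suc zero)    = unit , here ≈-refl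
  some n@(suc (suc m)) = join series (replicate n unit) ,
    Γ-complete {n = n} (series , join (s≤s (s≤s z≤n)) (AllP.replicate⁺ n unit)) (units n)
  nonEmpty : ∀ {cs} → (∃ λ c → c ∈ cs) → NonZero (length cs)
  nonEmpty {_ ∷ _} _ = _

M : (n : ℕ) → .{{NonZero n}} → ℚ
M n = R n ℚ.* (+ 1 ℚ./ Q n) {{Q-nonZero n}}

{-# OPTIONS --safe #-}
-- Let a n be the number of series n-circuits; duality (the exchange of series
-- and parallel, which inverts resistances) makes it the number of parallel ones
-- too, and pairing γ with its dual gives 1 ≤ M n from x + 1/x ≥ 2.
--
-- For the upper bound, S n ≤ 6 a n and P n ≤ 2 a n by simultaneous induction,
-- where S n and P n are the total resistances of the series and the parallel
-- n-circuits; hence M n ≤ 4.  Let c n d be the number of occurrences of a given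
-- part of size d in all series n-circuits.  Adding up the sizes of all parts
-- gives n·a n = Σ d·(a d)·(c n d) and, after symmetrisation,
--   Σ_{2≤d≤n-2} a d · a (n-d) ≤ a n − a (n-1),
-- which bounds S n = Σ (P d)·(c n d).
-- For P n, a parallel circuit with a unit part has resistance at most 1, and one
-- with k ≥ 2 parts, none a unit, at most 1/(2k) of the sum of the resistances of
-- its parts, which is at most 3 on average.  So P n ≤ 3 a n − 4 a (n-1), and it
-- remains to see that a n ≤ 4 a (n-1).  In fact n·a n ≤ (4n−6)·a (n-1), the
-- recurrence of the Catalan numbers: fed into the symmetrised identity, this
-- inequality for smaller n reproduces itself.
module Submission where

open import Defs
open import Algebra.Structures using (IsCommutativeRing; IsCommutativeSemiring)
import Data.Integer as ℤ
open import Data.List using (List; []; _∷_; _++_; map; concatMap; filter; foldr; length; replicate; upTo)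
import Data.List.Properties as ListP
open import Data.List.Relation.Unary.All as All using (All; []; _∷_)
import Data.List.Relation.Unary.All.Properties as AllP
open import Data.Nat as ℕ using (ℕ; zero; suc; s≤s; z≤n; NonZero)
open import Data.Nat.Induction using (<-rec)
open import Data.Nat.ListAction using (sum)
import Data.Nat.Properties as ℕP
open import Data.Nat.Tactic.RingSolver using (solve-∀)
open import Data.Product using (_×_; _,_; proj₁; proj₂)
open import Data.Sum using (inj₁; inj₂)
open import Function using (_∘_; const; id)
open import Relation.Binary.PropositionalEquality
open import Relation.Nullary using (Dec; yes; no)
open import Relation.Nullary.Decidable using (toWitness)
open import Relation.Unary using (Decidable)

-- Enumerating multisets

module _ where

  open import Data.Nat using (_+_; _*_; _∸_; _≤_; _<_; _≤?_)

  -- The cut-off N is kept apart from m: taking away one copy of an element lowers m by s but N only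
  -- by one. `multiplicities-bound` readjusts it afterwards.
  multiplicities : ℕ → ℕ → ℕ → List ℕ
  multiplicities s m N = filter (λ k → k * s ≤? m) (upTo N)

  upTo-suc : ∀ N → upTo (suc N) ≡ 0 ∷ map suc (upTo N)
  upTo-suc N = cong (0 ∷_) (sym (ListP.map-upTo suc N))

  filter-map : ∀ {A B : Set} {P : B → Set} (P? : Decidable P) (f : A → B) xs →
    filter P? (map f xs) ≡ map f (filter (P? ∘ f) xs)
  filter-map P? f [] = refl
  filter-map P? f (x ∷ xs) with P? (f x)
  ... | yes _ = cong (f x ∷_) (filter-map P? f xs)
  ... | no _  = filter-map P? f xs

  multiplicities-suc : ∀ s m N →
    multiplicities s m (suc N) ≡ 0 ∷ map suc (filter (λ k → suc k * s ≤? m) (upTo N))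
  multiplicities-suc s m N =
    trans (cong (filter (λ k → k * s ≤? m)) (upTo-suc N)) (cong (0 ∷_) (filter-map (λ k → k * s ≤? m) suc (upTo N)))

  multiplicities-< : ∀ s m N → m < s → multiplicities s m (suc N) ≡ 0 ∷ []
  multiplicities-< s m N m<s = trans (multiplicities-suc s m N) (cong (λ l → 0 ∷ map suc l)
    (ListP.filter-none (λ k → suc k * s ≤? m) (All.universal
      (λ k le → ℕP.<⇒≱ m<s (ℕP.≤-trans (ℕP.m≤m+n s (k * s)) le)) (upTo N))))

  multiplicities-+ : ∀ s m N → multiplicities s (s + m) (suc N) ≡ 0 ∷ map suc (multiplicities s m N)
  multiplicities-+ s m N = trans (multiplicities-suc s (s + m) N) (cong (λ l → 0 ∷ map suc l)
    (ListP.filter-≐ (λ k → suc k * s ≤? s + m) (λ k → k * s ≤? m)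
      ((λ {k} → ℕP.+-cancelˡ-≤ s _ _) , (λ {k} → ℕP.+-monoʳ-≤ s)) (upTo N)))

  -- For s ≥ 1 the condition k * s ≤ m already forces k ≤ m, so every cut-off above m gives the same
  -- list.
  multiplicities-bound : ∀ s → 1 ≤ s → ∀ m N N′ → m < N → m < N′ →
    multiplicities s m N ≡ multiplicities s m N′
  multiplicities-bound s 1≤s m (suc N) (suc N′) (s≤s m≤N) (s≤s m≤N′) with s ≤? m
  ... | no s≰m = trans (multiplicities-< s m N (ℕP.≰⇒> s≰m)) (sym (multiplicities-< s m N′ (ℕP.≰⇒> s≰m)))
  ... | yes s≤m with m ∸ s | ℕP.m+[n∸m]≡n s≤m
  ...   | p | refl = begin
    multiplicities s (s + p) (suc N)   ≡⟨ multiplicities-+ s p N ⟩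
    0 ∷ map suc (multiplicities s p N)
      ≡⟨ cong (λ l → 0 ∷ map suc l) (multiplicities-bound s 1≤s p N N′ (ℕP.≤-trans p<s+p m≤N) (ℕP.≤-trans p<s+p m≤N′)) ⟩
    0 ∷ map suc (multiplicities s p N′) ≡⟨ multiplicities-+ s p N′ ⟨
    multiplicities s (s + p) (suc N′)  ∎
    where
    open ≡-Reasoning
    p<s+p : suc p ≤ s + p
    p<s+p = ℕP.+-monoˡ-≤ p 1≤s

  multisets-< : ∀ c cs n → n < size c → multisets (c ∷ cs) n ≡ multisets cs n
  multisets-< c cs n n<c = trans
    (cong (concatMap (λ k → map (replicate k c ++_) (multisets cs (n ∸ k * size c)))) (multiplicities-< (size c) n n n<c))
    (trans (ListP.++-identityʳ _) (ListP.map-id _))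

  -- Either c does not occur, or one copy of it can be removed and the rest is again arbitrary. This
  -- is the identity 1/(1 - x^s) = 1 + x^s/(1 - x^s), and it holds for the lists in their order of
  -- enumeration.
  multisets-+ : ∀ c cs m → 1 ≤ size c →
    multisets (c ∷ cs) (size c + m) ≡ multisets cs (size c + m) ++ map (c ∷_) (multisets (c ∷ cs) m)
  multisets-+ c cs m 1≤c = begin
    concatMap F (multiplicities s (s + m) (suc (s + m)))
      ≡⟨ cong (concatMap F) (multiplicities-+ s m (s + m)) ⟩
    map id (multisets cs (s + m)) ++ concatMap F (map suc (multiplicities s m (s + m)))
      ≡⟨ cong₂ _++_ (ListP.map-id _) (trans (ListP.concatMap-map F suc (multiplicities s m (s + m)))
           (cong (concatMap (F ∘ suc)) (multiplicities-bound s 1≤c m (s + m) (suc m) (ℕP.+-monoˡ-≤ m 1≤c) ℕP.≤-refl))) ⟩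
    multisets cs (s + m) ++ concatMap (F ∘ suc) (multiplicities s m (suc m))
      ≡⟨ cong (multisets cs (s + m) ++_) (ListP.concatMap-cong step (multiplicities s m (suc m))) ⟩
    multisets cs (s + m) ++ concatMap (map (c ∷_) ∘ G) (multiplicities s m (suc m))
      ≡⟨ cong (multisets cs (s + m) ++_) (ListP.map-concatMap (c ∷_) G (multiplicities s m (suc m))) ⟨
    multisets cs (s + m) ++ map (c ∷_) (multisets (c ∷ cs) m)  ∎
    where
    open ≡-Reasoning
    s = size c
    F G : ℕ → List (List Circuit)
    F k = map (replicate k c ++_) (multisets cs (s + m ∸ k * s))
    G k = map (replicate k c ++_) (multisets cs (m ∸ k * s))
    step : ∀ k → F (suc k) ≡ map (c ∷_) (G k)
    step k = trans (ListP.map-∘ _) (cong (map (c ∷_) ∘ map (replicate k c ++_) ∘ multisets cs)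
      (ℕP.[m+n]∸[m+o]≡n∸o s m (k * s)))

  atMost-1≤size : ∀ k n → All (λ c → 1 ≤ size c) (atMost k n)
  atMost-1≤size k n = All.map (λ (i , _) → 1≤size i) (atMost-sound k n)

  line : ℕ → Circuit
  line n = join series (replicate n unit)

  size-line : ∀ n → size (line n) ≡ n
  size-line zero    = refl
  size-line (suc n) = cong suc (size-line n)

  line-1≤size : ∀ n → 1 ≤ size (line (suc n))
  line-1≤size n = s≤s z≤n

-- Weighted sums over multisets

-- The semiring is ℕ when circuits are counted and ℚ when resistances are added.
module Sums {A : Set} {plus times : A → A → A} {0# 1# : A}
            (isCSR : IsCommutativeSemiring _≡_ plus times 0# 1#) where

  open import Data.Nat using (_≤_; _<_; _≤?_; _∸_)
  open IsCommutativeSemiring isCSR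
    using (+-assoc; +-comm; +-identityˡ; +-identityʳ; *-comm; distribˡ; zeroʳ)

  infixl 6 _+_
  infixl 7 _*_

  _+_ _*_ : A → A → A
  _+_ = plus
  _*_ = times

  ∑ : ∀ {X : Set} → List X → (X → A) → A
  ∑ xs f = foldr _+_ 0# (map f xs)

  +-interchange : ∀ a b c d → (a + b) + (c + d) ≡ (a + c) + (b + d)
  +-interchange a b c d = begin
    (a + b) + (c + d)  ≡⟨ +-assoc a b (c + d) ⟩
    a + (b + (c + d))  ≡⟨ cong (a +_) (+-assoc b c d) ⟨
    a + ((b + c) + d)  ≡⟨ cong (λ x → a + (x + d)) (+-comm b c) ⟩
    a + ((c + b) + d)  ≡⟨ cong (a +_) (+-assoc c b d) ⟩
    a + (c + (b + d))  ≡⟨ +-assoc a c (b + d) ⟨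
    (a + c) + (b + d)  ∎
    where open ≡-Reasoning

  module _ {X : Set} where

    ∑-cong : ∀ {f g : X → A} {xs} → All (λ x → f x ≡ g x) xs → ∑ xs f ≡ ∑ xs g
    ∑-cong []       = refl
    ∑-cong (e ∷ es) = cong₂ _+_ e (∑-cong es)

    ∑-ext : ∀ {f g : X → A} → (∀ x → f x ≡ g x) → ∀ xs → ∑ xs f ≡ ∑ xs g
    ∑-ext e xs = ∑-cong (All.universal e xs)

    ∑-++ : ∀ (f : X → A) xs ys → ∑ (xs ++ ys) f ≡ ∑ xs f + ∑ ys f
    ∑-++ f []       ys = sym (+-identityˡ _)
    ∑-++ f (x ∷ xs) ys = trans (cong (f x +_) (∑-++ f xs ys)) (sym (+-assoc _ _ _))

    ∑-distrib-+ : ∀ (f g : X → A) xs → ∑ xs (λ x → f x + g x) ≡ ∑ xs f + ∑ xs g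
    ∑-distrib-+ f g []       = sym (+-identityˡ 0#)
    ∑-distrib-+ f g (x ∷ xs) = trans (cong (f x + g x +_) (∑-distrib-+ f g xs)) (+-interchange _ _ _ _)

    ∑-*ˡ : ∀ a (f : X → A) xs → ∑ xs (λ x → a * f x) ≡ a * ∑ xs f
    ∑-*ˡ a f []       = sym (zeroʳ a)
    ∑-*ˡ a f (x ∷ xs) = trans (cong (a * f x +_) (∑-*ˡ a f xs)) (sym (distribˡ a _ _))

    ∑-*ʳ : ∀ a (f : X → A) xs → ∑ xs (λ x → f x * a) ≡ ∑ xs f * a
    ∑-*ʳ a f xs = trans (∑-ext (λ x → *-comm (f x) a) xs) (trans (∑-*ˡ a f xs) (*-comm a _))

  ∑-map : ∀ {X Y : Set} (f : Y → A) (g : X → Y) xs → ∑ (map g xs) f ≡ ∑ xs (f ∘ g)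
  ∑-map f g xs = cong (foldr _+_ 0#) (sym (ListP.map-∘ xs))

  -- Multiplication by x ^ s of the power series with coefficients u.
  shift : ℕ → (ℕ → A) → ℕ → A
  shift zero    u n       = u n
  shift (suc s) u zero    = 0#
  shift (suc s) u (suc n) = shift s u n

  shift-at : ∀ s u m → shift s u (s ℕ.+ m) ≡ u m
  shift-at zero    u m = refl
  shift-at (suc s) u m = shift-at s u m

  shift-< : ∀ s u {n} → n < s → shift s u n ≡ 0#
  shift-< (suc s) u {zero}  _         = refl
  shift-< (suc s) u {suc n} (s≤s n<s) = shift-< s u n<s

  shift-cong : ∀ s {u v : ℕ → A} n → (∀ m → s ℕ.+ m ≡ n → u m ≡ v m) → shift s u n ≡ shift s v n
  shift-cong zero    n       e = e n refl
  shift-cong (suc s) zero    e = refl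
  shift-cong (suc s) (suc n) e = shift-cong s n (λ m eq → e m (cong suc eq))

  shift-ext : ∀ s {u v : ℕ → A} → (∀ m → u m ≡ v m) → ∀ n → shift s u n ≡ shift s v n
  shift-ext s e n = shift-cong s n (λ m _ → e m)

  shift-+ : ∀ s u v n → shift s (λ m → u m + v m) n ≡ shift s u n + shift s v n
  shift-+ zero    u v n       = refl
  shift-+ (suc s) u v zero    = sym (+-identityˡ 0#)
  shift-+ (suc s) u v (suc n) = shift-+ s u v n

  shift-* : ∀ s a u n → shift s (λ m → a * u m) n ≡ a * shift s u n
  shift-* zero    a u n       = refl
  shift-* (suc s) a u zero    = sym (zeroʳ a)
  shift-* (suc s) a u (suc n) = shift-* s a u n

  shift-∘ : ∀ s t u n → shift s (shift t u) n ≡ shift (s ℕ.+ t) u n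
  shift-∘ zero    t u n       = refl
  shift-∘ (suc s) t u zero    = refl
  shift-∘ (suc s) t u (suc n) = shift-∘ s t u n

  shift-comm : ∀ s t u n → shift s (shift t u) n ≡ shift t (shift s u) n
  shift-comm s t u n = trans (shift-∘ s t u n)
    (trans (cong (λ i → shift i u n) (ℕP.+-comm s t)) (sym (shift-∘ t s u n)))

  shift-∑ : ∀ {X : Set} s (u : X → ℕ → A) xs n → shift s (λ m → ∑ xs (λ x → u x m)) n ≡ ∑ xs (λ x → shift s (u x) n)
  shift-∑ zero    u xs n       = refl
  shift-∑ (suc s) u []       zero = refl
  shift-∑ (suc s) u (x ∷ xs) zero = trans (shift-∑ (suc s) u xs zero) (sym (+-identityˡ _))
  shift-∑ (suc s) u xs (suc n) = shift-∑ s u xs n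

  module _ {s} (1≤s : 1 ≤ s) {u u′ v v′ : (ℕ → A) → ℕ → A}
           (u-rec  : ∀ φ n → u  φ n ≡ v  φ n + shift s (u  (φ ∘ suc)) n)
           (u′-rec : ∀ φ n → u′ φ n ≡ v′ φ n + shift s (u′ (φ ∘ suc)) n) where

    -- Since s ≥ 1, the recursion expresses the value at n by values at smaller arguments, so v up
    -- to N determines u up to N. All φ are treated at once because the recursion passes from φ to φ
    -- ∘ suc.
    shift-rec-unique : ∀ N → (∀ φ n → n ≤ N → v φ n ≡ v′ φ n) → ∀ φ n → n ≤ N → u φ n ≡ u′ φ n
    shift-rec-unique N v≡v′ φ n = <-rec (λ n → ∀ φ → n ≤ N → u φ n ≡ u′ φ n) step n φ
      where
      step : ∀ n → (∀ {m} → m < n → ∀ φ → m ≤ N → u φ m ≡ u′ φ m) → ∀ φ → n ≤ N → u φ n ≡ u′ φ n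
      step n rec φ n≤N = begin
        u φ n                               ≡⟨ u-rec φ n ⟩
        v φ n + shift s (u (φ ∘ suc)) n     ≡⟨ cong₂ _+_ (v≡v′ φ n n≤N) (shift-cong s n λ m eq →
                                                 rec (smaller m eq) (φ ∘ suc) (ℕP.≤-trans (ℕP.<⇒≤ (smaller m eq)) n≤N)) ⟩
        v′ φ n + shift s (u′ (φ ∘ suc)) n   ≡⟨ u′-rec φ n ⟨
        u′ φ n                              ∎
        where
        open ≡-Reasoning
        smaller : ∀ m → s ℕ.+ m ≡ n → m < n
        smaller m refl = ℕP.+-monoˡ-≤ m 1≤s

  -- Recursion on the elements available to a multiset

  ∑-multisets : ∀ c cs → 1 ≤ size c → ∀ F n →
    ∑ (multisets (c ∷ cs) n) F ≡
    ∑ (multisets cs n) F + shift (size c) (λ m → ∑ (multisets (c ∷ cs) m) (λ ds → F (c ∷ ds))) n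
  ∑-multisets c cs 1≤c F n with size c ≤? n
  ... | no c≰n = begin
    ∑ (multisets (c ∷ cs) n) F     ≡⟨ cong (λ l → ∑ l F) (multisets-< c cs n (ℕP.≰⇒> c≰n)) ⟩
    ∑ (multisets cs n) F           ≡⟨ +-identityʳ _ ⟨
    ∑ (multisets cs n) F + 0#      ≡⟨ cong (∑ (multisets cs n) F +_) (shift-< (size c) _ (ℕP.≰⇒> c≰n)) ⟨
    ∑ (multisets cs n) F + _       ∎
    where open ≡-Reasoning
  ... | yes c≤n with n ∸ size c | ℕP.m+[n∸m]≡n c≤n
  ...   | m | refl = begin
    ∑ (multisets (c ∷ cs) (size c ℕ.+ m)) F
      ≡⟨ cong (λ l → ∑ l F) (multisets-+ c cs m 1≤c) ⟩
    ∑ (multisets cs (size c ℕ.+ m) ++ map (c ∷_) (multisets (c ∷ cs) m)) F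
      ≡⟨ ∑-++ F (multisets cs (size c ℕ.+ m)) _ ⟩
    ∑ (multisets cs (size c ℕ.+ m)) F + ∑ (map (c ∷_) (multisets (c ∷ cs) m)) F
      ≡⟨ cong (∑ (multisets cs (size c ℕ.+ m)) F +_)
           (trans (∑-map F (c ∷_) (multisets (c ∷ cs) m)) (sym (shift-at (size c) _ m))) ⟩
    ∑ (multisets cs (size c ℕ.+ m)) F + _  ∎
    where open ≡-Reasoning

  -- The weight φ sees only the number of elements: `const 1` counts multisets, while `ψ` supplies
  -- the factor 1/(2k) for parallel circuits with k parts. Removing one element replaces φ by φ ∘
  -- suc.
  weight : List Circuit → (ℕ → A) → ℕ → A
  weight cs φ n = ∑ (multisets cs n) (φ ∘ length)

  weight-∷ : ∀ c cs → 1 ≤ size c → ∀ φ n →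
    weight (c ∷ cs) φ n ≡ weight cs φ n + shift (size c) (weight (c ∷ cs) (φ ∘ suc)) n
  weight-∷ c cs 1≤c φ n = ∑-multisets c cs 1≤c (φ ∘ length) n

  -- The recursion involves the head only through its size, so both sides solve the same recursion.
  weight-size : ∀ c d cs → 1 ≤ size c → size c ≡ size d → ∀ φ n → weight (c ∷ cs) φ n ≡ weight (d ∷ cs) φ n
  weight-size c d cs 1≤c c≡d φ n = shift-rec-unique 1≤c {v = weight cs} {v′ = weight cs}
    (weight-∷ c cs 1≤c)
    (λ φ n → trans (weight-∷ d cs (subst (1 ≤_) c≡d 1≤c) φ n)
      (cong (λ s → weight cs φ n + shift s (weight (d ∷ cs) (φ ∘ suc)) n) (sym c≡d)))
    n (λ _ _ _ → refl) φ n ℕP.≤-refl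

  -- Lets the second element be taken out in place of the first. Both sides solve the same recursion
  -- in d, because the shifts by the two sizes commute.
  weight-swap : ∀ c d cs → 1 ≤ size c → 1 ≤ size d → ∀ φ n →
    weight (d ∷ c ∷ cs) φ n ≡ weight (d ∷ cs) φ n + shift (size c) (weight (d ∷ c ∷ cs) (φ ∘ suc)) n
  weight-swap c d cs 1≤c 1≤d φ n = shift-rec-unique 1≤d {v = weight (c ∷ cs)} {v′ = weight (c ∷ cs)}
    (weight-∷ d (c ∷ cs) 1≤d) swapped n (λ _ _ _ → refl) φ n ℕP.≤-refl
    where
    s = size c
    t = size d
    w = weight (d ∷ c ∷ cs)
    swapped : ∀ φ n → weight (d ∷ cs) φ n + shift s (w (φ ∘ suc)) n ≡
      weight (c ∷ cs) φ n + shift t (λ m → weight (d ∷ cs) (φ ∘ suc) m + shift s (w (φ ∘ suc ∘ suc)) m) n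
    swapped φ n = begin
      weight (d ∷ cs) φ n + shift s (w φ₁) n
        ≡⟨ cong₂ _+_ (weight-∷ d cs 1≤d φ n)
             (trans (shift-ext s (weight-∷ d (c ∷ cs) 1≤d φ₁) n) (shift-+ s _ _ n)) ⟩
      (weight cs φ n + shift t (weight (d ∷ cs) φ₁) n) + (shift s (weight (c ∷ cs) φ₁) n + shift s (shift t (w φ₂)) n)
        ≡⟨ +-interchange _ _ _ _ ⟩
      (weight cs φ n + shift s (weight (c ∷ cs) φ₁) n) + (shift t (weight (d ∷ cs) φ₁) n + shift s (shift t (w φ₂)) n)
        ≡⟨ cong₂ _+_ (sym (weight-∷ c cs 1≤c φ n))
             (trans (cong (shift t (weight (d ∷ cs) φ₁) n +_) (shift-comm s t (w φ₂) n)) (sym (shift-+ t _ _ n))) ⟩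
      weight (c ∷ cs) φ n + shift t (λ m → weight (d ∷ cs) φ₁ m + shift s (w φ₂) m) n  ∎
      where
      open ≡-Reasoning
      φ₁ = φ ∘ suc
      φ₂ = φ ∘ suc ∘ suc

  marked : List Circuit → (Circuit → A) → (ℕ → A) → ℕ → A
  marked cs f φ n = ∑ (multisets cs n) (λ ds → φ (length ds) * ∑ ds f)

  -- A multiset containing c gives up one copy: this copy contributes f c, and the remaining
  -- elements form a marked multiset with φ moved by one.
  marked-∷ : ∀ c cs f → 1 ≤ size c → ∀ φ n → marked (c ∷ cs) f φ n ≡
    (marked cs f φ n + shift (size c) (λ m → f c * weight (c ∷ cs) (φ ∘ suc) m) n) +
    shift (size c) (marked (c ∷ cs) f (φ ∘ suc)) n
  marked-∷ c cs f 1≤c φ n = begin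
    marked (c ∷ cs) f φ n
      ≡⟨ ∑-multisets c cs 1≤c _ n ⟩
    marked cs f φ n + shift s (λ m → ∑ (multisets (c ∷ cs) m) (λ ds → φ₁ (length ds) * (f c + ∑ ds f))) n
      ≡⟨ cong (marked cs f φ n +_) (trans (shift-ext s split-head n) (shift-+ s _ _ n)) ⟩
    marked cs f φ n + (shift s (λ m → f c * weight (c ∷ cs) φ₁ m) n + shift s (marked (c ∷ cs) f φ₁) n)
      ≡⟨ +-assoc _ _ _ ⟨
    (marked cs f φ n + shift s (λ m → f c * weight (c ∷ cs) φ₁ m) n) + shift s (marked (c ∷ cs) f φ₁) n  ∎
    where
    open ≡-Reasoning
    s  = size c
    φ₁ = φ ∘ suc
    split-head : ∀ m → ∑ (multisets (c ∷ cs) m) (λ ds → φ₁ (length ds) * (f c + ∑ ds f)) ≡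
      f c * weight (c ∷ cs) φ₁ m + marked (c ∷ cs) f φ₁ m
    split-head m = trans
      (∑-ext (λ ds → trans (distribˡ (φ₁ (length ds)) (f c) (∑ ds f)) (cong₂ _+_ (*-comm (φ₁ (length ds)) (f c)) refl)) (multisets (c ∷ cs) m))
      (trans (∑-distrib-+ _ _ (multisets (c ∷ cs) m)) (cong₂ _+_ (∑-*ˡ (f c) (φ₁ ∘ length) (multisets (c ∷ cs) m)) refl))

  -- Σ over multisets of the multiplicity of c is Σ over j ≥ 1 of the number of
  -- multisets containing at least j copies of c; taking j - 1 of these copies
  -- from a second element of the size of c turns the latter into a multiset
  -- over c ∷ cs.
  marked-sum : ∀ {cs} → All (λ c → 1 ≤ size c) cs → ∀ f φ n →
    marked cs f φ n ≡ ∑ cs (λ c → f c * shift (size c) (weight (c ∷ cs) (φ ∘ suc)) n)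
  marked-sum [] f φ zero    = trans (cong (_+ 0#) (zeroʳ _)) (+-identityʳ 0#)
  marked-sum [] f φ (suc n) = refl
  marked-sum {c ∷ cs} (1≤c ∷ 1≤cs) f φ n = shift-rec-unique 1≤c {u = marked (c ∷ cs) f} {v = v} {v′ = v}
    (marked-∷ c cs f 1≤c) rhs-rec n (λ _ _ _ → refl) φ n ℕP.≤-refl
    where
    s = size c
    v rhs : (ℕ → A) → ℕ → A
    v φ n = marked cs f φ n + shift s (λ m → f c * weight (c ∷ cs) (φ ∘ suc) m) n
    rhs φ n = f c * shift s (weight (c ∷ c ∷ cs) (φ ∘ suc)) n +
              ∑ cs (λ d → f d * shift (size d) (weight (d ∷ c ∷ cs) (φ ∘ suc)) n)
    -- The right-hand side of the claim obeys `marked-∷` too: c is taken out by `weight-∷` in its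
    -- own summand and by `weight-swap` in the others.
    rhs-rec : ∀ φ n → rhs φ n ≡ v φ n + shift s (rhs (φ ∘ suc)) n
    rhs-rec φ n = begin
      rhs φ n
        ≡⟨ cong₂ _+_ (expand c s (weight-∷ c (c ∷ cs) 1≤c φ₁))
             (trans (∑-cong (All.map (λ {d} 1≤d → expand d (size d) (weight-swap c d cs 1≤c 1≤d φ₁)) 1≤cs)) (∑-distrib-+ _ _ cs)) ⟩
      (f c * shift s (weight (c ∷ cs) φ₁) n + shift s (λ m → f c * shift s (weight (c ∷ c ∷ cs) φ₂) m) n) +
      (∑ cs (λ d → f d * shift (size d) (weight (d ∷ cs) φ₁) n) +
       ∑ cs (λ d → shift s (λ m → f d * shift (size d) (weight (d ∷ c ∷ cs) φ₂) m) n))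
        ≡⟨ cong₂ _+_ refl (cong₂ _+_ (sym (marked-sum 1≤cs f φ n)) (sym (shift-∑ s _ cs n))) ⟩
      (f c * shift s (weight (c ∷ cs) φ₁) n + shift s (λ m → f c * shift s (weight (c ∷ c ∷ cs) φ₂) m) n) +
      (marked cs f φ n + shift s (λ m → ∑ cs (λ d → f d * shift (size d) (weight (d ∷ c ∷ cs) φ₂) m)) n)
        ≡⟨ +-interchange _ _ _ _ ⟩
      (f c * shift s (weight (c ∷ cs) φ₁) n + marked cs f φ n) +
      (shift s (λ m → f c * shift s (weight (c ∷ c ∷ cs) φ₂) m) n +
       shift s (λ m → ∑ cs (λ d → f d * shift (size d) (weight (d ∷ c ∷ cs) φ₂) m)) n)
        ≡⟨ cong₂ _+_ (trans (+-comm _ _) (cong (marked cs f φ n +_) (sym (shift-* s (f c) _ n)))) (sym (shift-+ s _ _ n)) ⟩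
      v φ n + shift s (rhs φ₁) n  ∎
      where
      open ≡-Reasoning
      φ₁ = φ ∘ suc
      φ₂ = φ ∘ suc ∘ suc
      expand : ∀ d t {u v w : ℕ → A} → (∀ m → u m ≡ v m + shift s w m) →
        f d * shift t u n ≡ f d * shift t v n + shift s (λ m → f d * shift t w m) n
      expand d t {u} {v} {w} eq = begin
        f d * shift t u n
          ≡⟨ cong (f d *_) (trans (shift-ext t eq n) (shift-+ t v (shift s w) n)) ⟩
        f d * (shift t v n + shift t (shift s w) n)            ≡⟨ distribˡ (f d) _ _ ⟩
        f d * shift t v n + f d * shift t (shift s w) n
          ≡⟨ cong (λ x → f d * shift t v n + f d * x) (shift-comm t s w n) ⟩
        f d * shift t v n + f d * shift s (shift t w) n
          ≡⟨ cong (f d * shift t v n +_) (shift-* s (f d) (shift t w) n) ⟨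
        f d * shift t v n + shift s (λ m → f d * shift t w m) n  ∎

  -- An element larger than N cannot occur in a multiset of total size at most N.
  weight-++-> : ∀ {cs} → All (λ c → 1 ≤ size c) cs → ∀ {N ds} → All (λ d → N < size d) ds →
    ∀ φ n → n ≤ N → weight (cs ++ ds) φ n ≡ weight cs φ n
  weight-++-> [] [] φ n n≤N = refl
  weight-++-> [] {N} {d ∷ ds} (N<d ∷ N<ds) φ n n≤N = begin
    weight (d ∷ ds) φ n
      ≡⟨ cong (λ l → ∑ l (φ ∘ length)) (multisets-< d ds n (ℕP.≤-trans (s≤s n≤N) N<d)) ⟩
    weight ds φ n                       ≡⟨ weight-++-> [] N<ds φ n n≤N ⟩
    weight [] φ n                       ∎
    where open ≡-Reasoning
  weight-++-> {c ∷ cs} (1≤c ∷ 1≤cs) {N} {ds} N<ds φ n n≤N =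
    shift-rec-unique 1≤c {v = weight (cs ++ ds)} {v′ = weight cs}
      (weight-∷ c (cs ++ ds) 1≤c) (weight-∷ c cs 1≤c) N (weight-++-> 1≤cs N<ds) φ n n≤N

  weight-zero : ∀ {cs} → All (λ c → 1 ≤ size c) cs → ∀ φ → weight cs φ 0 ≡ φ 0
  weight-zero []                     φ = +-identityʳ _
  weight-zero {c ∷ cs} (1≤c ∷ 1≤cs) φ =
    trans (cong (λ l → ∑ l (φ ∘ length)) (multisets-< c cs 0 1≤c)) (weight-zero 1≤cs φ)

  -- Convolution sums over the antidiagonal i + j = N

  diag : (ℕ → ℕ → A) → ℕ → A
  diag F zero    = F 0 0
  diag F (suc N) = F 0 (suc N) + diag (F ∘ suc) N

  diag-cong : ∀ N {F G : ℕ → ℕ → A} → (∀ i j → i ℕ.+ j ≡ N → F i j ≡ G i j) → diag F N ≡ diag G N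
  diag-cong zero    e = e 0 0 refl
  diag-cong (suc N) e = cong₂ _+_ (e 0 (suc N) refl) (diag-cong N (λ i j eq → e (suc i) j (cong suc eq)))

  diag-last : ∀ N F → diag F (suc N) ≡ diag (λ i j → F i (suc j)) N + F (suc N) 0
  diag-last zero    F = refl
  diag-last (suc N) F = trans (cong (F 0 (suc (suc N)) +_) (diag-last N (F ∘ suc))) (sym (+-assoc _ _ _))

  diag-+ : ∀ N F G → diag (λ i j → F i j + G i j) N ≡ diag F N + diag G N
  diag-+ zero    F G = refl
  diag-+ (suc N) F G = trans (cong (F 0 (suc N) + G 0 (suc N) +_) (diag-+ N (F ∘ suc) (G ∘ suc))) (+-interchange _ _ _ _)

  diag-* : ∀ N a F → diag (λ i j → a * F i j) N ≡ a * diag F N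
  diag-* zero    a F = refl
  diag-* (suc N) a F = trans (cong (a * F 0 (suc N) +_) (diag-* N a (F ∘ suc))) (sym (distribˡ a _ _))

  diag-flip : ∀ N F → diag F N ≡ diag (λ i j → F j i) N
  diag-flip zero    F = refl
  diag-flip (suc N) F = begin
    F 0 (suc N) + diag (F ∘ suc) N                   ≡⟨ +-comm _ _ ⟩
    diag (F ∘ suc) N + F 0 (suc N)                   ≡⟨ cong₂ _+_ (diag-flip N (F ∘ suc)) refl ⟩
    diag (λ i j → F (suc j) i) N + F 0 (suc N)       ≡⟨ diag-last N (λ i j → F j i) ⟨
    diag (λ i j → F j i) (suc N)                     ∎
    where open ≡-Reasoning

  ∑-atMost : ∀ k F N → ∑ (atMost k (suc N)) F ≡ diag (λ i _ → ∑ (exactly k (suc i)) F) N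
  ∑-atMost k F zero    = refl
  ∑-atMost k F (suc N) = begin
    ∑ (atMost k (suc N) ++ exactly k (suc (suc N))) F               ≡⟨ ∑-++ F (atMost k (suc N)) _ ⟩
    ∑ (atMost k (suc N)) F + ∑ (exactly k (suc (suc N))) F          ≡⟨ cong₂ _+_ (∑-atMost k F N) refl ⟩
    diag (λ i _ → ∑ (exactly k (suc i)) F) N + _
      ≡⟨ diag-last N (λ i _ → ∑ (exactly k (suc i)) F) ⟨
    diag (λ i _ → ∑ (exactly k (suc i)) F) (suc N)                  ∎
    where open ≡-Reasoning

  ∑-exactly : ∀ k n f (X : ℕ → A) → ∑ (exactly k n) (λ c → f c * X (size c)) ≡ ∑ (exactly k n) f * X n
  ∑-exactly k n f X = trans
    (∑-cong (All.map (λ {c} (_ , eq) → cong (λ s → f c * X s) eq) (exactly-sound k n)))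
    (∑-*ʳ (X n) f (exactly k n))

  -- Frees the supply of elements from the bound N, so that the factors of a convolution depend on
  -- their own index alone. The prefix xs leaves room for a `line`.
  weight-stable : ∀ {xs} → All (λ c → 1 ≤ size c) xs → ∀ k φ {m} N → m ≤ N →
    weight (xs ++ atMost k N) φ m ≡ weight (xs ++ atMost k m) φ m
  weight-stable 1≤xs k φ {m} N m≤N with ℕP.m≤n⇒m<n∨m≡n m≤N
  ... | inj₂ refl = refl
  weight-stable {xs} 1≤xs k φ {m} (suc N) _ | inj₁ (s≤s m≤N) = begin
    weight (xs ++ (atMost k N ++ exactly k (suc N))) φ m
      ≡⟨ cong (λ cs → weight cs φ m) (ListP.++-assoc xs (atMost k N) _) ⟨
    weight ((xs ++ atMost k N) ++ exactly k (suc N)) φ m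
      ≡⟨ weight-++-> (AllP.++⁺ 1≤xs (atMost-1≤size k N))
                                                                (All.map (λ (_ , eq) → ℕP.≤-reflexive (sym eq)) (exactly-sound k (suc N))) φ m m≤N ⟩
    weight (xs ++ atMost k N) φ m                          ≡⟨ weight-stable 1≤xs k φ N m≤N ⟩
    weight (xs ++ atMost k m) φ m                          ∎
    where open ≡-Reasoning

  -- In `marked-sum` the cofactor of f c depends only on the size of c. Hence the circuits of equal
  -- size are collected, and `line (suc i)` replaces the second copy of c in the supply.
  marked-atMost : ∀ k f φ N → marked (atMost k (suc N)) f φ (suc (suc N)) ≡
    diag (λ i j → ∑ (exactly k (suc i)) f * weight (line (suc i) ∷ atMost k (suc j)) (φ ∘ suc) (suc j)) N
  marked-atMost k f φ N = begin
    marked cs f φ (suc (suc N))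
      ≡⟨ marked-sum (atMost-1≤size k (suc N)) f φ (suc (suc N)) ⟩
    ∑ cs (λ c → f c * shift (size c) (weight (c ∷ cs) (φ ∘ suc)) (suc (suc N)))
      ≡⟨ ∑-cong (All.map (λ {c} 1≤c → cong (f c *_) (shift-ext (size c)
           (weight-size c (line (size c)) cs 1≤c (sym (size-line (size c))) (φ ∘ suc)) (suc (suc N)))) (atMost-1≤size k (suc N))) ⟩
    ∑ cs (λ c → f c * X (size c))
      ≡⟨ ∑-atMost k _ N ⟩
    diag (λ i _ → ∑ (exactly k (suc i)) (λ c → f c * X (size c))) N
      ≡⟨ diag-cong N (λ i j eq → trans (∑-exactly k (suc i) f X) (cong (∑ (exactly k (suc i)) f *_) (X-at i j eq))) ⟩
    diag (λ i j → ∑ (exactly k (suc i)) f * weight (line (suc i) ∷ atMost k (suc j)) (φ ∘ suc) (suc j)) N  ∎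
    where
    open ≡-Reasoning
    cs = atMost k (suc N)
    X : ℕ → A
    X d = shift d (weight (line d ∷ cs) (φ ∘ suc)) (suc (suc N))
    X-at : ∀ i j → i ℕ.+ j ≡ N → X (suc i) ≡ weight (line (suc i) ∷ atMost k (suc j)) (φ ∘ suc) (suc j)
    X-at i j refl = begin
      shift i w (suc (i ℕ.+ j))     ≡⟨ cong (shift i w) (ℕP.+-suc i j) ⟨
      shift i w (i ℕ.+ suc j)       ≡⟨ shift-at i w (suc j) ⟩
      w (suc j)
        ≡⟨ weight-stable {line (suc i) ∷ []} (line-1≤size i ∷ []) k (φ ∘ suc) (suc (i ℕ.+ j)) (s≤s (ℕP.m≤n+m j i)) ⟩
      weight (line (suc i) ∷ atMost k (suc j)) (φ ∘ suc) (suc j) ∎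
      where w = weight (line (suc i) ∷ cs) (φ ∘ suc)

-- Numbers of circuits

module _ where

  open import Data.Nat using (_+_; _*_; _∸_; _≤_; _<_; _≤?_)

  -- Duality between series and parallel circuits

  mutual
    flip : Circuit → Circuit
    flip unit        = unit
    flip (join k cs) = join (dual k) (flips cs)

    flips : List Circuit → List Circuit
    flips []       = []
    flips (c ∷ cs) = flip c ∷ flips cs

  flips≡map : ∀ cs → flips cs ≡ map flip cs
  flips≡map []       = refl
  flips≡map (c ∷ cs) = cong (flip c ∷_) (flips≡map cs)

  mutual
    size-flip : ∀ c → size (flip c) ≡ size c
    size-flip unit        = refl
    size-flip (join _ cs) = cong sum (sizes-flips cs)

    sizes-flips : ∀ cs → sizes (flips cs) ≡ sizes cs
    sizes-flips []       = refl
    sizes-flips (c ∷ cs) = cong₂ _∷_ (size-flip c) (sizes-flips cs)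

  -- The enumeration looks at sizes only, which `flip` preserves; the two lists therefore agree even
  -- in their order.
  multisets-flip : ∀ cs n → multisets (map flip cs) n ≡ map (map flip) (multisets cs n)
  multisets-flip []       zero    = refl
  multisets-flip []       (suc n) = refl
  multisets-flip (c ∷ cs) n rewrite size-flip c = begin
    concatMap (λ k → map (replicate k (flip c) ++_) (multisets (map flip cs) (n ∸ k * size c))) ks
      ≡⟨ ListP.concatMap-cong step ks ⟩
    concatMap (map (map flip) ∘ G) ks
      ≡⟨ ListP.map-concatMap (map flip) G ks ⟨
    map (map flip) (concatMap G ks) ∎
    where
    open ≡-Reasoning
    ks = multiplicities (size c) n (suc n)
    G : ℕ → List (List Circuit)
    G k = map (replicate k c ++_) (multisets cs (n ∸ k * size c))
    step : ∀ k → map (replicate k (flip c) ++_) (multisets (map flip cs) (n ∸ k * size c)) ≡ map (map flip) (G k)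
    step k = begin
      map (replicate k (flip c) ++_) (multisets (map flip cs) (n ∸ k * size c))
        ≡⟨ cong (map _) (multisets-flip cs (n ∸ k * size c)) ⟩
      map (replicate k (flip c) ++_) (map (map flip) (multisets cs (n ∸ k * size c)))
        ≡⟨ ListP.map-∘ (multisets cs (n ∸ k * size c)) ⟨
      map (λ ds → replicate k (flip c) ++ map flip ds) (multisets cs (n ∸ k * size c))
        ≡⟨ ListP.map-cong (λ ds → trans (cong (_++ map flip ds) (sym (ListP.map-replicate flip k c)))
             (sym (ListP.map-++ flip (replicate k c) ds))) (multisets cs (n ∸ k * size c)) ⟩
      map (λ ds → map flip (replicate k c ++ ds)) (multisets cs (n ∸ k * size c))
        ≡⟨ ListP.map-∘ (multisets cs (n ∸ k * size c)) ⟩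
      map (map flip) (G k) ∎

  mutual
    exactly-flip : ∀ k n → exactly (dual k) n ≡ map flip (exactly k n)
    exactly-flip k zero          = refl
    exactly-flip k (suc zero)    = refl
    exactly-flip k (suc (suc n)) = begin
      map (join (dual k)) (multisets (atMost (dual (dual k)) (suc n)) (suc (suc n)))
        ≡⟨ cong (λ l → map (join (dual k)) (multisets l (suc (suc n)))) (atMost-flip (dual k) (suc n)) ⟩
      map (join (dual k)) (multisets (map flip cs) (suc (suc n)))
        ≡⟨ cong (map (join (dual k))) (multisets-flip cs (suc (suc n))) ⟩
      map (join (dual k)) (map (map flip) (multisets cs (suc (suc n))))
        ≡⟨ ListP.map-∘ (multisets cs (suc (suc n))) ⟨
      map (λ ds → join (dual k) (map flip ds)) (multisets cs (suc (suc n)))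
        ≡⟨ ListP.map-cong (λ ds → cong (join (dual k)) (sym (flips≡map ds))) (multisets cs (suc (suc n))) ⟩
      map (flip ∘ join k) (multisets cs (suc (suc n)))
        ≡⟨ ListP.map-∘ (multisets cs (suc (suc n))) ⟩
      map flip (map (join k) (multisets cs (suc (suc n))))  ∎
      where
      open ≡-Reasoning
      cs = atMost (dual k) (suc n)

    atMost-flip : ∀ k n → atMost (dual k) n ≡ map flip (atMost k n)
    atMost-flip k zero    = refl
    atMost-flip k (suc n) = trans (cong₂ _++_ (atMost-flip k n) (exactly-flip k (suc n)))
      (sym (ListP.map-++ flip (atMost k n) (exactly k (suc n))))

  -- Describes the parallel parts of a series circuit by their duals, so that all later sums run
  -- over series circuits.
  exactly-series : ∀ n → exactly series (suc (suc n)) ≡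
    map (λ ds → join series (map flip ds)) (multisets (atMost series (suc n)) (suc (suc n)))
  exactly-series n = begin
    map (join series) (multisets (atMost parallel (suc n)) (suc (suc n)))
      ≡⟨ cong (λ l → map (join series) (multisets l (suc (suc n)))) (atMost-flip series (suc n)) ⟩
    map (join series) (multisets (map flip (atMost series (suc n))) (suc (suc n)))
      ≡⟨ cong (map (join series)) (multisets-flip (atMost series (suc n)) (suc (suc n))) ⟩
    map (join series) (map (map flip) (multisets (atMost series (suc n)) (suc (suc n))))
      ≡⟨ ListP.map-∘ (multisets (atMost series (suc n)) (suc (suc n))) ⟨
    map (λ ds → join series (map flip ds)) (multisets (atMost series (suc n)) (suc (suc n)))  ∎
    where open ≡-Reasoning

  -- Counting multisets of series circuits

  open module ℕΣ = Sums ℕP.+-*-isCommutativeSemiring using (∑; shift; weight; marked; diag)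

  ∑-1 : ∀ {X : Set} (xs : List X) → ∑ xs (const 1) ≡ length xs
  ∑-1 []       = refl
  ∑-1 (x ∷ xs) = cong suc (∑-1 xs)

  count : List Circuit → ℕ → ℕ
  count cs = weight cs (const 1)

  a : ℕ → ℕ
  a n = length (exactly series n)

  -- The Euler transform of `a`: its generating function is the product of (1 - x^d)^(- a d) over d
  -- ≥ 1. In particular e 0 = e 1 = 1.
  e : ℕ → ℕ
  e n = count (atMost series n) n

  -- Multisets which may use one more element of size d, represented by line d;
  -- in terms of generating functions, g d = e / (1 - x ^ d).
  g : ℕ → ℕ → ℕ
  g d n = count (line d ∷ atMost series n) n

  -- In a multiset of total size N + 1 an element of that very size stands alone, so each member of
  -- ds adds exactly one multiset.
  count-++-top : ∀ {cs} → All (λ c → 1 ≤ size c) cs → ∀ N {ds} → All (λ d → size d ≡ suc N) ds →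
    count (cs ++ ds) (suc N) ≡ count cs (suc N) + length ds
  count-++-top [] N [] = refl
  count-++-top [] N {d ∷ ds} (d≡ ∷ ds≡) = begin
    count (d ∷ ds) (suc N)
      ≡⟨ ℕΣ.weight-∷ d ds (positive d d≡) (const 1) (suc N) ⟩
    count ds (suc N) + shift (size d) (count (d ∷ ds)) (suc N)
      ≡⟨ cong₂ _+_ (count-++-top [] N ds≡) last-one ⟩
    length ds + 1                                                ≡⟨ ℕP.+-comm (length ds) 1 ⟩
    suc (length ds)                                              ∎
    where
    open ≡-Reasoning
    positive : ∀ c → size c ≡ suc N → 1 ≤ size c
    positive _ eq = subst (1 ≤_) (sym eq) (s≤s z≤n)
    last-one : shift (size d) (count (d ∷ ds)) (suc N) ≡ 1
    last-one = begin
      shift (size d) (count (d ∷ ds)) (suc N)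
        ≡⟨ cong (shift (size d) (count (d ∷ ds))) (trans (sym d≡) (sym (ℕP.+-identityʳ (size d)))) ⟩
      shift (size d) (count (d ∷ ds)) (size d + 0) ≡⟨ ℕΣ.shift-at (size d) _ 0 ⟩
      count (d ∷ ds) 0
        ≡⟨ ℕΣ.weight-zero {d ∷ ds} (positive d d≡ ∷ All.map (λ {c} → positive c) ds≡) (const 1) ⟩
      1                                            ∎
  count-++-top {c ∷ cs} (1≤c ∷ 1≤cs) N {ds} ds≡ = begin
    count (c ∷ cs ++ ds) (suc N)
      ≡⟨ ℕΣ.weight-∷ c (cs ++ ds) 1≤c (const 1) (suc N) ⟩
    count (cs ++ ds) (suc N) + shift (size c) (count (c ∷ cs ++ ds)) (suc N)
      ≡⟨ cong₂ _+_ (count-++-top 1≤cs N ds≡) (ℕΣ.shift-cong (size c) (suc N) λ m eq →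
           ℕΣ.weight-++-> (1≤c ∷ 1≤cs) (All.map (λ d≡ → ℕP.≤-reflexive (sym d≡)) ds≡) (const 1) m (smaller m eq)) ⟩
    (count cs (suc N) + length ds) + shift (size c) (count (c ∷ cs)) (suc N)
      ≡⟨ ℕP.+-assoc (count cs (suc N)) _ _ ⟩
    count cs (suc N) + (length ds + shift (size c) (count (c ∷ cs)) (suc N))
      ≡⟨ cong (count cs (suc N) +_) (ℕP.+-comm (length ds) _) ⟩
    count cs (suc N) + (shift (size c) (count (c ∷ cs)) (suc N) + length ds)
      ≡⟨ ℕP.+-assoc (count cs (suc N)) _ _ ⟨
    (count cs (suc N) + shift (size c) (count (c ∷ cs)) (suc N)) + length ds
      ≡⟨ cong (_+ length ds) (ℕΣ.weight-∷ c cs 1≤c (const 1) (suc N)) ⟨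
    count (c ∷ cs) (suc N) + length ds ∎
    where
    open ≡-Reasoning
    smaller : ∀ m → size c + m ≡ suc N → m ≤ N
    smaller m eq = ℕP.≤-pred (subst (suc m ≤_) eq (ℕP.+-monoˡ-≤ m 1≤c))

  a-count : ∀ n → a (2 + n) ≡ count (atMost series (suc n)) (2 + n)
  a-count n = begin
    length (exactly series (2 + n))                              ≡⟨ cong length (exactly-series n) ⟩
    length (map (λ ds → join series (map flip ds)) multis)       ≡⟨ ListP.length-map _ multis ⟩
    length multis                                                ≡⟨ ∑-1 multis ⟨
    count (atMost series (suc n)) (2 + n)                        ∎
    where
    open ≡-Reasoning
    multis = multisets (atMost series (suc n)) (2 + n)

  -- A multiset of total size 2 + n either consists of smaller elements, and is then the multiset of
  -- parts of a circuit, or is a single circuit of that size.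
  e≡2a : ∀ n → e (2 + n) ≡ 2 * a (2 + n)
  e≡2a n = begin
    e (2 + n)
      ≡⟨ count-++-top (atMost-1≤size series (suc n)) (suc n) (All.map proj₂ (exactly-sound series (2 + n))) ⟩
    count (atMost series (suc n)) (2 + n) + a (2 + n)
      ≡⟨ cong (_+ a (2 + n)) (a-count n) ⟨
    a (2 + n) + a (2 + n)
      ≡⟨ cong (a (2 + n) +_) (ℕP.+-identityʳ _) ⟨
    2 * a (2 + n) ∎
    where open ≡-Reasoning

  g-rec : ∀ d n → g (suc d) n ≡ e n + shift (suc d) (g (suc d)) n
  g-rec d n = begin
    g (suc d) n
      ≡⟨ ℕΣ.weight-∷ (line (suc d)) (atMost series n) (line-1≤size d) (const 1) n ⟩
    e n + shift (size (line (suc d))) (count (line (suc d) ∷ atMost series n)) n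
      ≡⟨ cong (e n +_) (ℕΣ.shift-cong (size (line (suc d))) n (λ m eq →
           ℕΣ.weight-stable {line (suc d) ∷ []} (line-1≤size d ∷ []) series (const 1) n (subst (m ≤_) eq (ℕP.m≤n+m m _)))) ⟩
    e n + shift (size (line (suc d))) (g (suc d)) n
      ≡⟨ cong (λ s → e n + shift s (g (suc d)) n) (size-line (suc d)) ⟩
    e n + shift (suc d) (g (suc d)) n ∎
    where open ≡-Reasoning

  ∑-size : ∀ ds → ∑ ds size ≡ sum (sizes ds)
  ∑-size []       = refl
  ∑-size (d ∷ ds) = cong (size d +_) (∑-size ds)

  -- Both sides add up the sizes of all parts of all series circuits of size 2 + N. A given part of
  -- size suc i occurs `g (suc i) (suc j)` times, where i + j = N.
  size-identity : ∀ N → (2 + N) * a (2 + N) ≡ diag (λ i j → suc i * a (suc i) * g (suc i) (suc j)) N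
  size-identity N = begin
    (2 + N) * a (2 + N)                                    ≡⟨ cong ((2 + N) *_) (a-count N) ⟩
    (2 + N) * ∑ multis (const 1)                           ≡⟨ ℕΣ.∑-*ˡ (2 + N) (const 1) multis ⟨
    ∑ multis (λ _ → (2 + N) * 1)
      ≡⟨ ℕΣ.∑-cong (All.map (λ {ds} (_ , eq) → total ds eq)
                                                                (multisets-sound (atMost-sound series (suc N)) (2 + N))) ⟩
    marked (atMost series (suc N)) size (const 1) (2 + N)  ≡⟨ ℕΣ.marked-atMost series size (const 1) N ⟩
    diag (λ i j → ∑ (exactly series (suc i)) size * g (suc i) (suc j)) N
      ≡⟨ ℕΣ.diag-cong N (λ i j _ → cong (_* g (suc i) (suc j)) (total-size (suc i))) ⟩
    diag (λ i j → suc i * a (suc i) * g (suc i) (suc j)) N ∎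
    where
    open ≡-Reasoning
    multis = multisets (atMost series (suc N)) (2 + N)
    total : ∀ ds → sum (sizes ds) ≡ 2 + N → (2 + N) * 1 ≡ 1 * ∑ ds size
    total ds eq = begin
      (2 + N) * 1   ≡⟨ ℕP.*-comm (2 + N) 1 ⟩
      1 * (2 + N)   ≡⟨ cong (1 *_) (trans (∑-size ds) eq) ⟨
      1 * ∑ ds size ∎
    total-size : ∀ d → ∑ (exactly series d) size ≡ d * a d
    total-size d = begin
      ∑ (exactly series d) size
        ≡⟨ ℕΣ.∑-cong (All.map (λ (_ , eq) → trans eq (sym (ℕP.*-identityʳ d))) (exactly-sound series d)) ⟩
      ∑ (exactly series d) (λ _ → d * 1) ≡⟨ ℕΣ.∑-*ˡ d (const 1) (exactly series d) ⟩
      d * ∑ (exactly series d) (const 1) ≡⟨ cong (d *_) (∑-1 (exactly series d)) ⟩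
      d * a d                            ∎

  diag-mono : ∀ N {F G : ℕ → ℕ → ℕ} → (∀ i j → i + j ≡ N → F i j ≤ G i j) → diag F N ≤ diag G N
  diag-mono zero    le = le 0 0 refl
  diag-mono (suc N) le = ℕP.+-mono-≤ (le 0 (suc N) refl) (diag-mono N (λ i j eq → le (suc i) j (cong suc eq)))

  nonunits : Kind → ℕ → List Circuit
  nonunits k zero    = []
  nonunits k (suc n) = nonunits k n ++ exactly k (suc (suc n))

  atMost-unit : ∀ k n → atMost k (suc n) ≡ unit ∷ nonunits k n
  atMost-unit k zero    = refl
  atMost-unit k (suc n) = cong (_++ exactly k (suc (suc n))) (atMost-unit k n)

  -- The first summand counts circuits without a unit part; removing a unit from any other leaves an
  -- arbitrary multiset of total size 1 + n.
  a-split : ∀ n → a (2 + n) ≡ count (nonunits series n) (2 + n) + e (1 + n)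
  a-split n = begin
    a (2 + n)                                                            ≡⟨ a-count n ⟩
    count (atMost series (suc n)) (2 + n)
      ≡⟨ cong (λ cs → count cs (2 + n)) (atMost-unit series n) ⟩
    count (unit ∷ nonunits series n) (2 + n)
      ≡⟨ ℕΣ.weight-∷ unit (nonunits series n) (s≤s z≤n) (const 1) (2 + n) ⟩
    count (nonunits series n) (2 + n) + count (unit ∷ nonunits series n) (1 + n)
      ≡⟨ cong (λ cs → count (nonunits series n) (2 + n) + count cs (1 + n)) (atMost-unit series n) ⟨
    count (nonunits series n) (2 + n) + e (1 + n)                        ∎
    where open ≡-Reasoning

  e≤a : ∀ n → e (1 + n) ≤ a (2 + n)
  e≤a n = subst (e (1 + n) ≤_) (sym (a-split n)) (ℕP.m≤n+m _ _)

  e-double : ∀ n → 2 * e (1 + n) ≤ e (2 + n)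
  e-double n = subst (2 * e (1 + n) ≤_) (sym (e≡2a n)) (ℕP.*-monoʳ-≤ 2 (e≤a n))

  a-double : ∀ n → 2 * a (2 + n) ≤ a (3 + n)
  a-double n = subst (_≤ a (3 + n)) (e≡2a n) (e≤a (1 + n))

  -- The recurrence for the number of series circuits

  τ : ℕ → ℕ → ℕ
  τ d = shift d (g d)

  g-+ : ∀ i m → g (suc i) (suc i + m) ≡ e (suc i + m) + g (suc i) m
  g-+ i m = trans (g-rec i (suc i + m)) (cong (e (suc i + m) +_) (ℕΣ.shift-at (suc i) (g (suc i)) m))

  g-< : ∀ i {m} → m < suc i → g (suc i) m ≡ e m
  g-< i {m} m<d = trans (g-rec i m) (trans (cong (e m +_) (ℕΣ.shift-< (suc i) (g (suc i)) m<d)) (ℕP.+-identityʳ _))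

  -- The indices are shifted so that BB N, W N and T (2 + N) are the sums
  -- occurring in the identity for a (4 + N).  T collects the repeated copies of
  -- an element, and U the values e 0 = 1 that T-step cannot compare with a
  -- previous value of e.
  BB W T U : ℕ → ℕ
  BB = diag (λ i j → a (2 + i) * a (2 + j))
  W  = diag (λ i j → (2 + i) * (a (2 + i) * a (2 + j)))
  T  = diag (λ i j → suc i * a (suc i) * τ (suc i) (suc j))
  U  = diag (λ i j → suc i * a (suc i) * shift i (const 1) (suc j))

  -- Exchanging i and j and adding replaces the factor 2 + i by (2 + i) + (2 + j) = 4 + N.
  twice-W : ∀ N → 2 * W N ≡ (4 + N) * BB N
  twice-W N = begin
    2 * W N
      ≡⟨ (λ x → cong (x +_) (ℕP.+-identityʳ x)) (W N) ⟩
    W N + W N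
      ≡⟨ cong (W N +_) (ℕΣ.diag-flip N _) ⟩
    W N + diag (λ i j → (2 + j) * (a (2 + j) * a (2 + i))) N                    ≡⟨ ℕΣ.diag-+ N _ _ ⟨
    diag (λ i j → (2 + i) * (a (2 + i) * a (2 + j)) + (2 + j) * (a (2 + j) * a (2 + i))) N
      ≡⟨ ℕΣ.diag-cong N (λ { i j refl → factor i j (a (2 + i)) (a (2 + j)) }) ⟩
    diag (λ i j → (4 + N) * (a (2 + i) * a (2 + j))) N
      ≡⟨ ℕΣ.diag-* N (4 + N) _ ⟩
    (4 + N) * BB N                                                              ∎
    where
    open ≡-Reasoning
    factor : ∀ i j x y → (2 + i) * (x * y) + (2 + j) * (y * x) ≡ (4 + (i + j)) * (x * y)
    factor = solve-∀

  -- `size-identity` with g = e + τ. In the e-part, unit parts give 2 * a (3 + N), parts of size 3 +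
  -- N give (3 + N) * a (3 + N), and the sizes between give 2 * W N; the τ-part is T (2 + N).
  a-rec : ∀ N → (4 + N) * a (4 + N) ≡ (5 + N) * a (3 + N) + (4 + N) * BB N + T (2 + N)
  a-rec N = begin
    (4 + N) * a (4 + N)
      ≡⟨ size-identity (2 + N) ⟩
    diag (λ i j → suc i * a (suc i) * g (suc i) (suc j)) (2 + N)
      ≡⟨ ℕΣ.diag-cong (2 + N) (λ i j _ → trans (cong (suc i * a (suc i) *_) (g-rec i (suc j))) (ℕP.*-distribˡ-+ (suc i * a (suc i)) (e (suc j)) (τ (suc i) (suc j)))) ⟩
    diag (λ i j → suc i * a (suc i) * e (suc j) + suc i * a (suc i) * τ (suc i) (suc j)) (2 + N)
      ≡⟨ ℕΣ.diag-+ (2 + N) (λ i j → suc i * a (suc i) * e (suc j)) (λ i j → suc i * a (suc i) * τ (suc i) (suc j)) ⟩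
    diag (λ i j → suc i * a (suc i) * e (suc j)) (2 + N) + T (2 + N)
      ≡⟨ cong (_+ T (2 + N)) main ⟩
    (5 + N) * a (3 + N) + (4 + N) * BB N + T (2 + N) ∎
    where
    open ≡-Reasoning
    rearrange : ∀ n x y → 1 * (2 * x) + (2 * y + n * x * 1) ≡ (2 + n) * x + 2 * y
    rearrange = solve-∀
    assoc-2 : ∀ n x y → n * x * (2 * y) ≡ 2 * (n * (x * y))
    assoc-2 = solve-∀
    main : diag (λ i j → suc i * a (suc i) * e (suc j)) (2 + N) ≡ (5 + N) * a (3 + N) + (4 + N) * BB N
    main = begin
      1 * e (3 + N) + diag (λ i j → (2 + i) * a (2 + i) * e (suc j)) (1 + N)
        ≡⟨ cong₂ _+_ (cong (1 *_) (e≡2a (1 + N))) (ℕΣ.diag-last N (λ i j → (2 + i) * a (2 + i) * e (suc j))) ⟩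
      1 * (2 * a (3 + N)) + (diag (λ i j → (2 + i) * a (2 + i) * e (2 + j)) N + (3 + N) * a (3 + N) * 1)
        ≡⟨ cong (λ x → 1 * (2 * a (3 + N)) + (x + (3 + N) * a (3 + N) * 1))
             (trans (ℕΣ.diag-cong N (λ i j _ → trans (cong ((2 + i) * a (2 + i) *_) (e≡2a j)) (assoc-2 (2 + i) (a (2 + i)) (a (2 + j)))))
                    (ℕΣ.diag-* N 2 _)) ⟩
      1 * (2 * a (3 + N)) + (2 * W N + (3 + N) * a (3 + N) * 1)
        ≡⟨ rearrange (3 + N) (a (3 + N)) (W N) ⟩
      (5 + N) * a (3 + N) + 2 * W N
        ≡⟨ cong ((5 + N) * a (3 + N) +_) (twice-W N) ⟩
      (5 + N) * a (3 + N) + (4 + N) * BB N ∎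

  -- `a-rec` without T and without one copy of a (3 + N), divided by 4 + N.
  BB-bound : ∀ N → BB N + a (3 + N) ≤ a (4 + N)
  BB-bound N = ℕP.*-cancelˡ-≤ (4 + N) (begin
    (4 + N) * (BB N + a (3 + N))
      ≤⟨ ℕP.m≤m+n _ (a (3 + N) + T (2 + N)) ⟩
    (4 + N) * (BB N + a (3 + N)) + (a (3 + N) + T (2 + N))
      ≡⟨ rearrange N (BB N) (a (3 + N)) (T (2 + N)) ⟩
    (5 + N) * a (3 + N) + (4 + N) * BB N + T (2 + N)                      ≡⟨ a-rec N ⟨
    (4 + N) * a (4 + N)                                                   ∎)
    where
    open ℕP.≤-Reasoning
    rearrange : ∀ n x y t → (4 + n) * (x + y) + (y + t) ≡ (5 + n) * y + (4 + n) * x + t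
    rearrange = solve-∀

  -- Growth at most at the rate of the Catalan numbers

  Growth : ℕ → Set
  Growth i = (2 + i) * a (2 + i) ≤ (2 + 4 * i) * a (1 + i)

  -- `Growth` at 1 + i bounds (3 + i) * a (3 + i) by 4 (2 + i) - 2 times a (2 + i); the -2 becomes
  -- the term 2 * BB N on the left. The summand i = 0 of W (1 + N) stays separate and equals 2 * a
  -- (3 + N), as a 2 = 1.
  W-step : ∀ N → (∀ i → i ≤ 1 + N → Growth i) → W (1 + N) + 2 * BB N ≤ 2 * a (3 + N) + 4 * W N
  W-step N growth = begin
    2 * (1 * a (3 + N)) + diag (λ i j → (3 + i) * (a (3 + i) * a (2 + j))) N + 2 * BB N
      ≡⟨ cong (_+ 2 * BB N) (cong (_+ diag (λ i j → (3 + i) * (a (3 + i) * a (2 + j))) N) (cong (2 *_) (ℕP.*-identityˡ (a (3 + N))))) ⟩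
    2 * a (3 + N) + diag (λ i j → (3 + i) * (a (3 + i) * a (2 + j))) N + 2 * BB N
      ≡⟨ trans (ℕP.+-assoc (2 * a (3 + N)) _ _) (cong (2 * a (3 + N) +_)
           (trans (cong₂ _+_ refl (sym (ℕΣ.diag-* N 2 (λ i j → a (2 + i) * a (2 + j)))))
                  (sym (ℕΣ.diag-+ N (λ i j → (3 + i) * (a (3 + i) * a (2 + j))) (λ i j → 2 * (a (2 + i) * a (2 + j))))))) ⟩
    2 * a (3 + N) + diag (λ i j → (3 + i) * (a (3 + i) * a (2 + j)) + 2 * (a (2 + i) * a (2 + j))) N
      ≤⟨ ℕP.+-monoʳ-≤ (2 * a (3 + N)) (diag-mono N term) ⟩
    2 * a (3 + N) + diag (λ i j → 4 * ((2 + i) * (a (2 + i) * a (2 + j)))) N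
      ≡⟨ cong (2 * a (3 + N) +_) (ℕΣ.diag-* N 4 _) ⟩
    2 * a (3 + N) + 4 * W N ∎
    where
    open ℕP.≤-Reasoning
    rearrange : ∀ i x y → (2 + 4 * (1 + i)) * x * y + 2 * (x * y) ≡ 4 * ((2 + i) * (x * y))
    rearrange = solve-∀
    term : ∀ i j → i + j ≡ N →
      (3 + i) * (a (3 + i) * a (2 + j)) + 2 * (a (2 + i) * a (2 + j)) ≤ 4 * ((2 + i) * (a (2 + i) * a (2 + j)))
    term i j eq = begin
      (3 + i) * (a (3 + i) * a (2 + j)) + 2 * (a (2 + i) * a (2 + j))
        ≡⟨ cong (_+ 2 * (a (2 + i) * a (2 + j))) (ℕP.*-assoc (3 + i) (a (3 + i)) (a (2 + j))) ⟨
      (3 + i) * a (3 + i) * a (2 + j) + 2 * (a (2 + i) * a (2 + j))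
        ≤⟨ ℕP.+-monoˡ-≤ _ (ℕP.*-monoˡ-≤ (a (2 + j)) (growth (1 + i) (s≤s (subst (i ≤_) eq (ℕP.m≤m+n i j))))) ⟩
      (2 + 4 * (1 + i)) * a (2 + i) * a (2 + j) + 2 * (a (2 + i) * a (2 + j))
        ≡⟨ rearrange i (a (2 + i)) (a (2 + j)) ⟩
      4 * ((2 + i) * (a (2 + i) * a (2 + j))) ∎

  -- The shift in U restricts the sum to i ≤ j + 1. Raising i and j together keeps this condition,
  -- hence the step by two; `Growth` costs a factor of at most 4, and the new summand i = 0 is 1.
  U-step : ∀ M → (∀ i → i ≤ M → Growth i) → U (2 + M) ≤ 1 + 4 * U M
  U-step M growth = begin
    1 + diag (λ i j → (2 + i) * a (2 + i) * shift (1 + i) (const 1) (1 + j)) (1 + M)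
      ≡⟨ cong suc (ℕΣ.diag-last M (λ i j → (2 + i) * a (2 + i) * shift (1 + i) (const 1) (1 + j))) ⟩
    1 + (diag (λ i j → (2 + i) * a (2 + i) * shift i (const 1) (1 + j)) M + (3 + M) * a (3 + M) * shift (1 + M) (const 1) 0)
      ≡⟨ cong suc (trans (cong (diag (λ i j → (2 + i) * a (2 + i) * shift i (const 1) (1 + j)) M +_) (ℕP.*-zeroʳ ((3 + M) * a (3 + M)))) (ℕP.+-identityʳ _)) ⟩
    1 + diag (λ i j → (2 + i) * a (2 + i) * shift i (const 1) (1 + j)) M
      ≤⟨ s≤s (diag-mono M term) ⟩
    1 + diag (λ i j → 4 * (suc i * a (suc i) * shift i (const 1) (suc j))) M
      ≡⟨ cong suc (ℕΣ.diag-* M 4 _) ⟩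
    1 + 4 * U M ∎
    where
    open ℕP.≤-Reasoning
    rearrange : ∀ i x s → (2 + 4 * i) * x * s + 2 * x * s ≡ 4 * (suc i * x * s)
    rearrange = solve-∀
    term : ∀ i j → i + j ≡ M →
      (2 + i) * a (2 + i) * shift i (const 1) (1 + j) ≤ 4 * (suc i * a (suc i) * shift i (const 1) (suc j))
    term i j eq = begin
      (2 + i) * a (2 + i) * s
        ≤⟨ ℕP.*-monoˡ-≤ s (growth i (subst (i ≤_) eq (ℕP.m≤m+n i j))) ⟩
      (2 + 4 * i) * a (1 + i) * s                      ≤⟨ ℕP.m≤m+n _ _ ⟩
      (2 + 4 * i) * a (1 + i) * s + 2 * a (1 + i) * s  ≡⟨ rearrange i (a (1 + i)) s ⟩
      4 * (suc i * a (suc i) * s)                      ∎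
      where s = shift i (const 1) (suc j)

  -- Both sides grow by a factor of 4 in two steps.
  U-bound : ∀ M → (∀ i → i ≤ 5 + M → Growth i) → 1 + U (5 + M) ≤ a (6 + M)
  -- By evaluation, U 5 = U 6 = 29, a 6 = 33 and a 7 = 90.
  U-bound zero          growth = ℕP.m≤m+n 30 3
  U-bound (suc zero)    growth = ℕP.m≤m+n 30 60
  U-bound (suc (suc M)) growth = begin
    1 + U (7 + M)
      ≤⟨ s≤s (U-step (5 + M) (λ i i≤ → growth i (ℕP.m≤n⇒m≤1+n (ℕP.m≤n⇒m≤1+n i≤)))) ⟩
    2 + 4 * U (5 + M)           ≤⟨ ℕP.m≤n+m _ 2 ⟩
    4 + 4 * U (5 + M)           ≡⟨ ℕP.*-distribˡ-+ 4 1 (U (5 + M)) ⟨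
    4 * (1 + U (5 + M))
      ≤⟨ ℕP.*-monoʳ-≤ 4 (U-bound M (λ i i≤ → growth i (ℕP.m≤n⇒m≤1+n (ℕP.m≤n⇒m≤1+n i≤)))) ⟩
    4 * a (6 + M)               ≡⟨ ℕP.*-assoc 2 2 (a (6 + M)) ⟩
    2 * (2 * a (6 + M))         ≤⟨ ℕP.*-monoʳ-≤ 2 (a-double (4 + M)) ⟩
    2 * a (7 + M)               ≤⟨ a-double (5 + M) ⟩
    a (8 + M)                   ∎
    where open ℕP.≤-Reasoning

  -- τ d n is the sum of e (n - t d) over t ≥ 1 with t d ≤ n. Each e (suc m) is compared with e m;
  -- only a final e 0, present when d divides n, has no predecessor. It costs at most A, which the
  -- last summand provides.
  τ-step : ∀ A B i X → (∀ m → m < X → A * e (suc m) ≤ B * e m) →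
    A * τ (suc i) (suc X) ≤ B * τ (suc i) X + A * shift (suc i) (const 1) (suc X)
  τ-step A B i X = <-rec (λ X → (∀ m → m < X → A * e (suc m) ≤ B * e m) →
      A * τ (suc i) (suc X) ≤ B * τ (suc i) X + A * shift (suc i) (const 1) (suc X)) step X
    where
    step : ∀ X → (∀ {Y} → Y < X → (∀ m → m < Y → A * e (suc m) ≤ B * e m) →
        A * τ (suc i) (suc Y) ≤ B * τ (suc i) Y + A * shift (suc i) (const 1) (suc Y)) →
      (∀ m → m < X → A * e (suc m) ≤ B * e m) →
      A * τ (suc i) (suc X) ≤ B * τ (suc i) X + A * shift (suc i) (const 1) (suc X)
    step X rec le with i ≤? X
    ... | no i≰X =
      ℕP.≤-trans (ℕP.≤-reflexive (trans (cong (A *_) (ℕΣ.shift-< (suc i) (g (suc i)) (s≤s (ℕP.≰⇒> i≰X)))) (ℕP.*-zeroʳ A))) z≤n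
    ... | yes i≤X with X ∸ i | ℕP.m+[n∸m]≡n i≤X
    ...   | zero  | refl = begin
      A * shift i (g (suc i)) (i + 0)                   ≡⟨ cong (A *_) (ℕΣ.shift-at i (g (suc i)) 0) ⟩
      A * g (suc i) 0                                   ≡⟨ cong (A *_) (g-< i {0} (s≤s z≤n)) ⟩
      A * 1                                             ≡⟨ cong (A *_) (ℕΣ.shift-at i (const 1) 0) ⟨
      A * shift i (const 1) (i + 0)                     ≤⟨ ℕP.m≤n+m _ _ ⟩
      B * τ (suc i) (i + 0) + A * shift i (const 1) (i + 0) ∎
      where open ℕP.≤-Reasoning
    ...   | suc m | refl = begin
      A * shift i (g (suc i)) (i + suc m)
        ≡⟨ cong (A *_) (trans (ℕΣ.shift-at i (g (suc i)) (suc m)) (g-rec i (suc m))) ⟩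
      A * (e (suc m) + τ (suc i) (suc m))
        ≡⟨ ℕP.*-distribˡ-+ A _ _ ⟩
      A * e (suc m) + A * τ (suc i) (suc m)
        ≤⟨ ℕP.+-mono-≤ (le m m<) (rec m< (λ m′ m′< → le m′ (ℕP.<-trans m′< m<))) ⟩
      B * e m + (B * τ (suc i) m + A * shift (suc i) (const 1) (suc m))
        -- The leftover is not increased by the term e (suc m), so it remains at most one copy of A.
        ≤⟨ ℕP.+-monoʳ-≤ (B * e m) (ℕP.+-monoʳ-≤ (B * τ (suc i) m) (ℕP.*-monoʳ-≤ A (shift-≤1 i m))) ⟩
      B * e m + (B * τ (suc i) m + A * 1)
        ≡⟨ trans (sym (ℕP.+-assoc (B * e m) _ _)) (cong (_+ A * 1) (sym (ℕP.*-distribˡ-+ B (e m) _))) ⟩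
      B * (e m + τ (suc i) m) + A * 1
        ≡⟨ cong₂ (λ x y → B * x + A * y) (sym (trans (cong (shift (suc i) (g (suc i))) (ℕP.+-suc i m))
             (trans (ℕΣ.shift-at i (g (suc i)) m) (g-rec i m)))) (sym (ℕΣ.shift-at i (const 1) (suc m))) ⟩
      B * τ (suc i) (i + suc m) + A * shift i (const 1) (i + suc m) ∎
      where
      open ℕP.≤-Reasoning
      m< : m < i + suc m
      m< = ℕP.m≤n+m (suc m) i
      shift-≤1 : ∀ s n → shift s (const 1) n ≤ 1
      shift-≤1 zero    n       = ℕP.≤-refl
      shift-≤1 (suc s) zero    = z≤n
      shift-≤1 (suc s) (suc n) = shift-≤1 s n

  -- `τ-step` summed with the weights suc i * a (suc i); the leftovers add up to A * U M.
  T-step : ∀ A B M → (∀ m → m < 1 + M → A * e (suc m) ≤ B * e m) → A * T (1 + M) ≤ B * T M + A * U M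
  T-step A B M le = begin
    A * T (1 + M)
      ≡⟨ cong (A *_) (trans (ℕΣ.diag-last M (λ i j → suc i * a (suc i) * τ (suc i) (suc j))) (trans (cong (diag (λ i j → suc i * a (suc i) * τ (suc i) (2 + j)) M +_)
           (trans (cong ((2 + M) * a (2 + M) *_) (ℕΣ.shift-< (2 + M) (g (2 + M)) {1} (s≤s (s≤s z≤n)))) (ℕP.*-zeroʳ ((2 + M) * a (2 + M))))) (ℕP.+-identityʳ _))) ⟩
    A * diag (λ i j → suc i * a (suc i) * τ (suc i) (2 + j)) M
      ≡⟨ ℕΣ.diag-* M A _ ⟨
    diag (λ i j → A * (suc i * a (suc i) * τ (suc i) (2 + j))) M
      ≤⟨ diag-mono M term ⟩
    diag (λ i j → B * (suc i * a (suc i) * τ (suc i) (suc j)) + A * (suc i * a (suc i) * shift i (const 1) (suc j))) M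
      ≡⟨ trans (ℕΣ.diag-+ M _ _) (cong₂ _+_ (ℕΣ.diag-* M B _) (ℕΣ.diag-* M A _)) ⟩
    B * T M + A * U M ∎
    where
    open ℕP.≤-Reasoning
    swap-left : ∀ x y z → x * (y * z) ≡ y * (x * z)
    swap-left = solve-∀
    expand : ∀ c x y s t → c * (x * s + y * t) ≡ x * (c * s) + y * (c * t)
    expand = solve-∀
    term : ∀ i j → i + j ≡ M → A * (suc i * a (suc i) * τ (suc i) (2 + j)) ≤
      B * (suc i * a (suc i) * τ (suc i) (suc j)) + A * (suc i * a (suc i) * shift i (const 1) (suc j))
    term i j eq = begin
      A * (c * τ (suc i) (2 + j))                    ≡⟨ swap-left A c _ ⟩
      c * (A * τ (suc i) (2 + j))
        ≤⟨ ℕP.*-monoʳ-≤ c (τ-step A B i (suc j) (λ m m< → le m (ℕP.≤-trans m< (s≤s (subst (j ≤_) eq (ℕP.m≤n+m j i)))))) ⟩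
      c * (B * τ (suc i) (suc j) + A * shift i (const 1) (suc j))
        ≡⟨ expand c B A (τ (suc i) (suc j)) (shift i (const 1) (suc j)) ⟩
      B * (c * τ (suc i) (suc j)) + A * (c * shift i (const 1) (suc j)) ∎
      where c = suc i * a (suc i)

  -- The slack k makes the ratio the same for all m: it depends on m + k only, which `growth-step`
  -- fixes to be 5 + N.
  e-ratio : ∀ m k → (∀ i → i ≤ m → Growth i) → (2 + m + k) * e (suc m) ≤ (4 + 4 * (m + k)) * e m
  e-ratio zero k growth = ℕP.≤-trans (ℕP.≤-reflexive (ℕP.*-identityʳ (2 + k)))
    (ℕP.≤-trans (ℕP.+-mono-≤ (ℕP.m≤m+n 2 2) (ℕP.m≤m+n k (3 * k))) (ℕP.≤-reflexive (sym (ℕP.*-identityʳ (4 + 4 * k)))))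
  e-ratio (suc zero) k growth = subst₂ _≤_ (lhs k) (rhs k) (ℕP.m≤m+n (6 + 2 * k) (2 + 2 * k))
    where
    lhs : ∀ k → 6 + 2 * k ≡ (3 + k) * 2
    lhs = solve-∀
    rhs : ∀ k → 6 + 2 * k + (2 + 2 * k) ≡ (4 + 4 * (1 + k)) * 1
    rhs = solve-∀
  e-ratio (suc (suc m)) k growth = ℕP.*-cancelˡ-≤ (3 + m) (begin
    (3 + m) * ((4 + m + k) * e (3 + m))
      ≡⟨ cong (λ x → (3 + m) * ((4 + m + k) * x)) (e≡2a (1 + m)) ⟩
    (3 + m) * ((4 + m + k) * (2 * a (3 + m)))
      ≡⟨ lhs m k (a (3 + m)) ⟩
    2 * (4 + m + k) * ((3 + m) * a (3 + m))
      ≤⟨ ℕP.*-monoʳ-≤ (2 * (4 + m + k)) (growth (1 + m) (ℕP.n≤1+n (1 + m))) ⟩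
    2 * (4 + m + k) * ((2 + 4 * (1 + m)) * a (2 + m))
      ≤⟨ ℕP.m≤m+n _ (2 * ((12 + 2 * m + 6 * k) * a (2 + m))) ⟩
    2 * (4 + m + k) * ((2 + 4 * (1 + m)) * a (2 + m)) + 2 * ((12 + 2 * m + 6 * k) * a (2 + m))
      ≡⟨ rhs m k (a (2 + m)) ⟩
    (3 + m) * ((4 + 4 * (2 + m + k)) * (2 * a (2 + m)))
      ≡⟨ cong (λ x → (3 + m) * ((4 + 4 * (2 + m + k)) * x)) (e≡2a m) ⟨
    (3 + m) * ((4 + 4 * (2 + m + k)) * e (2 + m)) ∎)
    where
    open ℕP.≤-Reasoning
    lhs : ∀ m k x → (3 + m) * ((4 + m + k) * (2 * x)) ≡ 2 * (4 + m + k) * ((3 + m) * x)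
    lhs = solve-∀
    rhs : ∀ m k x →
      2 * (4 + m + k) * ((2 + 4 * (1 + m)) * x) + 2 * ((12 + 2 * m + 6 * k) * x) ≡ (3 + m) * ((4 + 4 * (2 + m + k)) * (2 * x))
    rhs = solve-∀

  -- In `a-rec` for a (8 + N), `b-step` and `t-step` replace BB and T by B times their predecessors.
  -- These complete to B times `a-rec` for a (7 + N), so BB and T disappear and only values of `a`
  -- remain.
  growth-step : ∀ N → (∀ i → i ≤ 5 + N → Growth i) → Growth (6 + N)
  -- The summand with x₂ is added on both sides because the right-hand side of `a-rec (3 + N)` needs
  -- it.
  growth-step N growth = ℕP.*-cancelˡ-≤ (7 + N) (ℕP.+-cancelʳ-≤ (B * (8 + N) * x₂) _ _ (begin
    (7 + N) * ((8 + N) * x₀) + B * (8 + N) * x₂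
      ≡⟨ cong (λ z → (7 + N) * z + B * (8 + N) * x₂) (a-rec (4 + N)) ⟩
    (7 + N) * ((9 + N) * x₁ + (8 + N) * b₀ + t₀) + B * (8 + N) * x₂
      ≡⟨ expand N x₁ x₂ b₀ t₀ ⟩
    (7 + N) * ((9 + N) * x₁ + (8 + N) * b₀) + (7 + N) * t₀ + B * (8 + N) * x₂
      ≤⟨ ℕP.+-monoˡ-≤ (B * (8 + N) * x₂) (ℕP.+-mono-≤
           (ℕP.*-monoʳ-≤ (7 + N) (ℕP.+-monoʳ-≤ ((9 + N) * x₁) b-step)) t-step) ⟩
    (7 + N) * ((9 + N) * x₁ + (4 * x₂ + B * b₁)) + (B * t₁ + (7 + N) * x₂) + B * (8 + N) * x₂
      ≡⟨ collect N x₁ x₂ b₁ t₁ ⟩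
    (7 + N) * (9 + N) * x₁ + 5 * (7 + N) * x₂ + B * ((8 + N) * x₂ + (7 + N) * b₁ + t₁)
      ≡⟨ cong (λ z → (7 + N) * (9 + N) * x₁ + 5 * (7 + N) * x₂ + B * z) (a-rec (3 + N)) ⟨
    (7 + N) * (9 + N) * x₁ + 5 * (7 + N) * x₂ + B * ((7 + N) * x₁)
      -- The coefficient 26 + 4 * N wanted for x₁ is set aside; the previous `Growth` turns the rest
      -- into a multiple of x₂, with (3 + N) * x₂ to spare.
      ≡⟨ separate N x₁ x₂ ⟩
    (7 + N) * ((7 + N) * x₁) + (5 * (7 + N) * x₂ + (26 + 4 * N) * (7 + N) * x₁)
      ≤⟨ ℕP.+-monoˡ-≤ _ (ℕP.*-monoʳ-≤ (7 + N) (growth (5 + N) ℕP.≤-refl)) ⟩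
    (7 + N) * ((2 + 4 * (5 + N)) * x₂) + (5 * (7 + N) * x₂ + (26 + 4 * N) * (7 + N) * x₁)
      ≤⟨ ℕP.m≤m+n _ ((3 + N) * x₂) ⟩
    (7 + N) * ((2 + 4 * (5 + N)) * x₂) + (5 * (7 + N) * x₂ + (26 + 4 * N) * (7 + N) * x₁) + ((3 + N) * x₂)
      ≡⟨ final N x₁ x₂ ⟩
    (7 + N) * ((2 + 4 * (6 + N)) * x₁) + B * (8 + N) * x₂  ∎))
    where
    open ℕP.≤-Reasoning
    -- This is 4 (7 + N) - 4: the -4 comes from the term 2 * BB of `W-step` after symmetrisation.
    -- The bound for T is made to use the same ratio.
    B = 24 + 4 * N
    x₀ = a (8 + N)
    x₁ = a (7 + N)
    x₂ = a (6 + N)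
    b₀ = BB (4 + N)
    b₁ = BB (3 + N)
    t₀ = T (6 + N)
    t₁ = T (5 + N)
    expand : ∀ n x₁ x₂ b t → (7 + n) * ((9 + n) * x₁ + (8 + n) * b + t) + (24 + 4 * n) * (8 + n) * x₂ ≡
      (7 + n) * ((9 + n) * x₁ + (8 + n) * b) + (7 + n) * t + (24 + 4 * n) * (8 + n) * x₂
    expand = solve-∀
    collect : ∀ n x₁ x₂ b t →
      (7 + n) * ((9 + n) * x₁ + (4 * x₂ + (24 + 4 * n) * b)) + ((24 + 4 * n) * t + (7 + n) * x₂) + (24 + 4 * n) * (8 + n) * x₂ ≡
      (7 + n) * (9 + n) * x₁ + 5 * (7 + n) * x₂ + (24 + 4 * n) * ((8 + n) * x₂ + (7 + n) * b + t)
    collect = solve-∀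
    separate : ∀ n x₁ x₂ → (7 + n) * (9 + n) * x₁ + 5 * (7 + n) * x₂ + (24 + 4 * n) * ((7 + n) * x₁) ≡
      (7 + n) * ((7 + n) * x₁) + (5 * (7 + n) * x₂ + (26 + 4 * n) * (7 + n) * x₁)
    separate = solve-∀
    final : ∀ n x₁ x₂ →
      (7 + n) * ((2 + 4 * (5 + n)) * x₂) + (5 * (7 + n) * x₂ + (26 + 4 * n) * (7 + n) * x₁) + (3 + n) * x₂ ≡
      (7 + n) * ((2 + 4 * (6 + n)) * x₁) + (24 + 4 * n) * (8 + n) * x₂
    final = solve-∀
    b-step : (8 + N) * b₀ ≤ 4 * x₂ + B * b₁
    b-step = ℕP.+-cancelʳ-≤ (4 * b₁) _ _ (begin
      (8 + N) * b₀ + 4 * b₁              ≡⟨ cong (_+ 4 * b₁) (twice-W (4 + N)) ⟨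
      2 * W (4 + N) + 4 * b₁             ≡⟨ double (W (4 + N)) b₁ ⟩
      2 * (W (4 + N) + 2 * b₁)
        ≤⟨ ℕP.*-monoʳ-≤ 2 (W-step (3 + N) (λ i i≤ → growth i (ℕP.m≤n⇒m≤1+n i≤))) ⟩
      2 * (2 * x₂ + 4 * W (3 + N))       ≡⟨ regroup x₂ (W (3 + N)) ⟩
      4 * x₂ + 4 * (2 * W (3 + N))       ≡⟨ cong (λ z → 4 * x₂ + 4 * z) (twice-W (3 + N)) ⟩
      4 * x₂ + 4 * ((7 + N) * b₁)        ≡⟨ splitB N x₂ b₁ ⟩
      4 * x₂ + B * b₁ + 4 * b₁           ∎)
      where
      double : ∀ w b → 2 * w + 4 * b ≡ 2 * (w + 2 * b)
      double = solve-∀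
      regroup : ∀ x w → 2 * (2 * x + 4 * w) ≡ 4 * x + 4 * (2 * w)
      regroup = solve-∀
      splitB : ∀ n x b → 4 * x + 4 * ((7 + n) * b) ≡ 4 * x + (24 + 4 * n) * b + 4 * b
      splitB = solve-∀
    ratio : ∀ m → m < 6 + N → (7 + N) * e (suc m) ≤ B * e m
    ratio m (s≤s m≤) with 5 + N ∸ m | ℕP.m+[n∸m]≡n m≤
    ... | k | eq =
      subst₂ (λ A B → A * e (suc m) ≤ B * e m) (cong (2 +_) eq) B≡ (e-ratio m k (λ i i≤ → growth i (ℕP.≤-trans i≤ m≤)))
      where
      expand-B : ∀ n → 4 + 4 * (5 + n) ≡ 24 + 4 * n
      expand-B = solve-∀
      B≡ : 4 + 4 * (m + k) ≡ B
      B≡ = trans (cong (λ z → 4 + 4 * z) eq) (expand-B N)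
    t-step : (7 + N) * t₀ ≤ B * t₁ + (7 + N) * x₂
    t-step = ℕP.≤-trans (T-step (7 + N) B (5 + N) ratio)
      (ℕP.+-monoʳ-≤ (B * t₁) (ℕP.*-monoʳ-≤ (7 + N) (ℕP.≤-trans (ℕP.n≤1+n _) (U-bound N growth))))

  growth : ∀ i → Growth i
  growth = <-rec Growth step
    where
    step : ∀ i → (∀ {j} → j < i → Growth j) → Growth i
    -- The values a 1, ..., a 7 are 1, 1, 2, 5, 12, 33, 90; equality holds for i ≤ 2.
    step 0 _ = ℕP.≤-refl
    step 1 _ = ℕP.≤-refl
    step 2 _ = ℕP.≤-refl
    step 3 _ = ℕP.m≤m+n 60 10
    step 4 _ = ℕP.m≤m+n 198 18
    step 5 _ = ℕP.m≤m+n 630 96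
    step (suc (suc (suc (suc (suc (suc N)))))) rec = growth-step N (λ i i≤ → rec (s≤s i≤))

  a-quadruple : ∀ n → a (2 + n) ≤ 4 * a (1 + n)
  a-quadruple n = ℕP.*-cancelˡ-≤ (2 + n) (begin
    (2 + n) * a (2 + n)                            ≤⟨ growth n ⟩
    (2 + 4 * n) * a (1 + n)                        ≤⟨ ℕP.m≤m+n _ (6 * a (1 + n)) ⟩
    (2 + 4 * n) * a (1 + n) + 6 * a (1 + n)        ≡⟨ rearrange n (a (1 + n)) ⟩
    (2 + n) * (4 * a (1 + n))                      ∎)
    where
    open ℕP.≤-Reasoning
    rearrange : ∀ n x → (2 + 4 * n) * x + 6 * x ≡ (2 + n) * (4 * x)
    rearrange = solve-∀

  -- How often a given part occurs

  e-mono : ∀ m → e m ≤ e (suc m)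
  e-mono zero    = ℕP.≤-refl
  e-mono (suc m) = ℕP.≤-trans (ℕP.m≤m+n (e (suc m)) _) (e-double m)

  -- g 1 n is e 0 + ... + e n, and since e at least doubles from 1 on, the terms before the last add
  -- up to at most the last.
  g₁-bound : ∀ m → g 1 (suc m) ≤ 2 * e (suc m)
  g₁-bound m = begin
    g 1 (suc m)              ≡⟨ g-+ 0 m ⟩
    e (suc m) + g 1 m        ≤⟨ ℕP.+-monoʳ-≤ (e (suc m)) (g₁≤e m) ⟩
    e (suc m) + e (suc m)    ≡⟨ cong (e (suc m) +_) (ℕP.+-identityʳ _) ⟨
    2 * e (suc m)            ∎
    where
    open ℕP.≤-Reasoning
    g₁≤e : ∀ m → g 1 m ≤ e (suc m)
    g₁≤e zero    = ℕP.≤-refl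
    g₁≤e (suc m) = ℕP.≤-trans (g₁-bound m) (e-double m)

  e-quadruple : ∀ i m → 4 * e (suc m) ≤ e (2 + i + suc m)
  e-quadruple zero    m = ℕP.≤-trans (ℕP.≤-reflexive (ℕP.*-assoc 2 2 (e (suc m))))
    (ℕP.≤-trans (ℕP.*-monoʳ-≤ 2 (e-double m)) (e-double (suc m)))
  e-quadruple (suc i) m = ℕP.≤-trans (e-quadruple i m) (e-mono (2 + i + suc m))

  -- g d n is the sum of e (n - t d) over t ≥ 0. For d ≥ 2 a term with positive argument is at most
  -- a quarter of the one before, and a final e 0 = 1 at most half. The constant 3/2 is attained: g
  -- 2 2 = 3 and e 2 = 2.
  g-bound : ∀ i m → 2 * g (2 + i) (suc m) ≤ 3 * e (suc m)
  g-bound i = <-rec (λ m → 2 * g (2 + i) (suc m) ≤ 3 * e (suc m)) step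
    where
    open ℕP.≤-Reasoning
    2≤e : ∀ n → 2 ≤ e (2 + n)
    2≤e zero    = ℕP.≤-refl
    2≤e (suc n) = ℕP.≤-trans (2≤e n) (e-mono (2 + n))
    step : ∀ m → (∀ {k} → k < m → 2 * g (2 + i) (suc k) ≤ 3 * e (suc k)) → 2 * g (2 + i) (suc m) ≤ 3 * e (suc m)
    step m rec with suc i ≤? m
    ... | no i≮m =
      ℕP.≤-trans (ℕP.≤-reflexive (cong (2 *_) (g-< (suc i) (s≤s (ℕP.≰⇒> i≮m))))) (ℕP.*-monoˡ-≤ (e (suc m)) (ℕP.n≤1+n 2))
    ... | yes i<m with m ∸ suc i | ℕP.m+[n∸m]≡n i<m
    ...   | zero  | refl = begin
      2 * g (2 + i) (2 + i + 0)                     ≡⟨ cong (2 *_) (g-+ (suc i) 0) ⟩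
      2 * (e (2 + i + 0) + g (2 + i) 0)
        ≡⟨ cong (λ z → 2 * (e (2 + i + 0) + z)) (g-< (suc i) {0} (s≤s z≤n)) ⟩
      2 * (e (2 + i + 0) + 1)                       ≡⟨ ℕP.*-distribˡ-+ 2 (e (2 + i + 0)) 1 ⟩
      2 * e (2 + i + 0) + 2                         ≤⟨ ℕP.+-monoʳ-≤ (2 * e (2 + i + 0)) (2≤e (i + 0)) ⟩
      2 * e (2 + i + 0) + e (2 + i + 0)             ≡⟨ ℕP.+-comm (2 * e (2 + i + 0)) _ ⟩
      3 * e (2 + i + 0)                             ∎
    ...   | suc k | refl = begin
      2 * g (2 + i) (2 + i + suc k)                 ≡⟨ cong (2 *_) (g-+ (suc i) (suc k)) ⟩
      2 * (e (2 + i + suc k) + g (2 + i) (suc k))   ≡⟨ ℕP.*-distribˡ-+ 2 (e (2 + i + suc k)) _ ⟩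
      2 * e (2 + i + suc k) + 2 * g (2 + i) (suc k)
        ≤⟨ ℕP.+-monoʳ-≤ (2 * e (2 + i + suc k)) (rec (ℕP.m≤n+m (suc k) (suc i))) ⟩
      2 * e (2 + i + suc k) + 3 * e (suc k)
        ≤⟨ ℕP.+-monoʳ-≤ (2 * e (2 + i + suc k)) (ℕP.≤-trans (ℕP.m≤n+m _ (e (suc k))) (e-quadruple i k)) ⟩
      2 * e (2 + i + suc k) + e (2 + i + suc k)     ≡⟨ ℕP.+-comm (2 * e (2 + i + suc k)) _ ⟩
      3 * e (2 + i + suc k)                         ∎

  -- The bound w i on the total resistance of the parallel circuits of size
  -- suc i: the unit circuit is not given the factor 2.
  w : ℕ → ℕ
  w zero    = 1
  w (suc i) = 2 * a (2 + i)

  -- Unit parts contribute at most 4 * a (3 + N), parts of size 3 + N at most 2 * a (3 + N), and the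
  -- sizes between at most 6 * BB N, as 2 · 3/2 · 2 = 6. `BB-bound` then applies to six times the
  -- sum.
  diag-w-bound : ∀ K → diag (λ i j → w i * g (suc i) (suc j)) K ≤ 6 * a (2 + K)
  diag-w-bound zero          = ℕP.m≤m+n 2 4
  diag-w-bound (suc zero)    = ℕP.m≤m+n 6 6
  diag-w-bound (suc (suc N)) = begin
    1 * g 1 (3 + N) + diag (λ i j → 2 * a (2 + i) * g (2 + i) (suc j)) (suc N)
      ≡⟨ cong (1 * g 1 (3 + N) +_) (ℕΣ.diag-last N (λ i j → 2 * a (2 + i) * g (2 + i) (suc j))) ⟩
    1 * g 1 (3 + N) + (diag (λ i j → 2 * a (2 + i) * g (2 + i) (2 + j)) N + 2 * a (3 + N) * g (3 + N) 1)
      ≤⟨ ℕP.+-mono-≤ first (ℕP.+-mono-≤ (diag-mono N middle) last) ⟩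
    4 * a (3 + N) + (diag (λ i j → 6 * (a (2 + i) * a (2 + j))) N + 2 * a (3 + N))
      ≡⟨ cong (λ z → 4 * a (3 + N) + (z + 2 * a (3 + N))) (ℕΣ.diag-* N 6 (λ i j → a (2 + i) * a (2 + j))) ⟩
    4 * a (3 + N) + (6 * BB N + 2 * a (3 + N))
      ≡⟨ rearrange (a (3 + N)) (BB N) ⟩
    6 * (BB N + a (3 + N))
      ≤⟨ ℕP.*-monoʳ-≤ 6 (BB-bound N) ⟩
    6 * a (4 + N) ∎
    where
    open ℕP.≤-Reasoning
    rearrange : ∀ x b → 4 * x + (6 * b + 2 * x) ≡ 6 * (b + x)
    rearrange = solve-∀
    first : 1 * g 1 (3 + N) ≤ 4 * a (3 + N)
    first = begin
      1 * g 1 (3 + N)       ≡⟨ ℕP.*-identityˡ _ ⟩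
      g 1 (3 + N)           ≤⟨ g₁-bound (2 + N) ⟩
      2 * e (3 + N)         ≡⟨ cong (2 *_) (e≡2a (1 + N)) ⟩
      2 * (2 * a (3 + N))   ≡⟨ ℕP.*-assoc 2 2 (a (3 + N)) ⟨
      4 * a (3 + N)         ∎
    middle : ∀ i j → i + j ≡ N → 2 * a (2 + i) * g (2 + i) (2 + j) ≤ 6 * (a (2 + i) * a (2 + j))
    middle i j _ = begin
      2 * a (2 + i) * g (2 + i) (2 + j)     ≡⟨ swap-2 (a (2 + i)) (g (2 + i) (2 + j)) ⟩
      a (2 + i) * (2 * g (2 + i) (2 + j))   ≤⟨ ℕP.*-monoʳ-≤ (a (2 + i)) (g-bound i (suc j)) ⟩
      a (2 + i) * (3 * e (2 + j))           ≡⟨ cong (λ z → a (2 + i) * (3 * z)) (e≡2a j) ⟩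
      a (2 + i) * (3 * (2 * a (2 + j)))     ≡⟨ collect-6 (a (2 + i)) (a (2 + j)) ⟩
      6 * (a (2 + i) * a (2 + j))           ∎
      where
      swap-2 : ∀ x y → 2 * x * y ≡ x * (2 * y)
      swap-2 = solve-∀
      collect-6 : ∀ x y → x * (3 * (2 * y)) ≡ 6 * (x * y)
      collect-6 = solve-∀
    last : 2 * a (3 + N) * g (3 + N) 1 ≤ 2 * a (3 + N)
    last = ℕP.≤-reflexive (trans (cong (2 * a (3 + N) *_) (g-< (2 + N) {1} (s≤s (s≤s z≤n)))) (ℕP.*-identityʳ _))

-- Resistances

open import Data.Rational as ℚ using (ℚ; 0ℚ; 1ℚ; _/_; _+_; _*_; -_; _-_; _≤_; _<_; Positive; nonNegative; positive)
import Data.Rational.Properties as ℚP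
open import Data.Rational.Solver using (module +-*-Solver)
import Data.Rational.Unnormalised as ℚᵘ
import Data.Rational.Unnormalised.Properties as ℚᵘP
open +-*-Solver using (solve; con; _:+_; _:*_; :-_; _:-_; _:=_)

open module ℚΣ = Sums (IsCommutativeRing.isCommutativeSemiring ℚP.+-*-isCommutativeRing)
  using (diag; diag-cong; marked; marked-atMost; marked-sum; shift; shift-ext; weight; weight-size; ∑; ∑-*ˡ; ∑-++; ∑-cong; ∑-distrib-+; ∑-exactly; ∑-ext; ∑-map; ∑-multisets)

-- Natural numbers and inequalities in the rationals

ι : ℕ → ℚ
ι zero    = 0ℚ
ι (suc n) = 1ℚ + ι n

ι-+ : ∀ m n → ι (m ℕ.+ n) ≡ ι m + ι n
ι-+ zero    n = sym (ℚP.+-identityˡ (ι n))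
ι-+ (suc m) n = trans (cong (1ℚ +_) (ι-+ m n)) (sym (ℚP.+-assoc 1ℚ (ι m) (ι n)))

ι-* : ∀ m n → ι (m ℕ.* n) ≡ ι m * ι n
ι-* zero    n = sym (ℚP.*-zeroˡ (ι n))
ι-* (suc m) n = begin
  ι (n ℕ.+ m ℕ.* n)      ≡⟨ ι-+ n (m ℕ.* n) ⟩
  ι n + ι (m ℕ.* n)      ≡⟨ cong₂ _+_ (sym (ℚP.*-identityˡ (ι n))) (ι-* m n) ⟩
  1ℚ * ι n + ι m * ι n   ≡⟨ ℚP.*-distribʳ-+ (ι n) 1ℚ (ι m) ⟨
  ι (suc m) * ι n        ∎
  where open ≡-Reasoning

0≤ι : ∀ n → 0ℚ ≤ ι n
0≤ι zero    = ℚP.≤-refl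
0≤ι (suc n) = ℚP.+-mono-≤ (ℚP.nonNegative⁻¹ 1ℚ) (0≤ι n)

ι-mono : ∀ {m n} → m ℕ.≤ n → ι m ≤ ι n
ι-mono {n = n} z≤n = 0≤ι n
ι-mono (s≤s m≤n)   = ℚP.+-monoʳ-≤ 1ℚ (ι-mono m≤n)

ι-positive : ∀ n → .{{_ : NonZero n}} → Positive (ι n)
ι-positive n@(suc _) = positive (ℚP.<-≤-trans (ℚP.positive⁻¹ 1ℚ) (ι-mono {1} {n} (s≤s z≤n)))

ι≡/1 : ∀ n → ℚ.toℚᵘ (ι n) ℚᵘ.≃ ℚᵘ.mkℚᵘ (ℤ.+ n) 0
ι≡/1 zero    = ℚᵘ.*≡* refl
ι≡/1 (suc n) = ℚᵘP.≃-trans (ℚP.toℚᵘ-homo-+ 1ℚ (ι n)) (ℚᵘP.≃-trans (ℚᵘP.+-congʳ (ℚ.toℚᵘ 1ℚ) (ι≡/1 n)) (add-one n))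
  where
  add-one : ∀ n → ℚᵘ.mkℚᵘ (ℤ.+ 1) 0 ℚᵘ.+ ℚᵘ.mkℚᵘ (ℤ.+ n) 0 ℚᵘ.≃ ℚᵘ.mkℚᵘ (ℤ.+ suc n) 0
  add-one zero    = ℚᵘ.*≡* refl
  add-one (suc n) = ℚᵘ.*≡* (cong (λ m → ℤ.+ (suc (suc m) ℕ.* 1)) (ℕP.*-identityʳ n))

-- The normalised fraction 1 / n does not compute for a variable n, so the product is compared among
-- unnormalised rationals.
ι-/ : ∀ n .{{_ : NonZero n}} → ι n * (ℤ.+ 1 / n) ≡ 1ℚ
ι-/ n@(suc m) = ℚP.toℚᵘ-injective (ℚᵘP.≃-trans (ℚP.toℚᵘ-homo-* (ι n) (ℤ.+ 1 / n))
  (ℚᵘP.≃-trans (ℚᵘP.*-cong (ι≡/1 n) (ℚP.toℚᵘ-fromℚᵘ (ℚᵘ.mkℚᵘ (ℤ.+ 1) m)))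
    (ℚᵘ.*≡* (trans (cong (λ k → ℤ.+ suc k) (m*1*1 m)) (sym (cong (λ k → ℤ.+ suc k) (m+0+0 m)))))))
  where
  m*1*1 : ∀ m → m ℕ.* 1 ℕ.* 1 ≡ m
  m*1*1 m = trans (ℕP.*-identityʳ (m ℕ.* 1)) (ℕP.*-identityʳ m)
  m+0+0 : ∀ m → m ℕ.+ 0 ℕ.+ 0 ≡ m
  m+0+0 m = trans (ℕP.+-identityʳ (m ℕ.+ 0)) (ℕP.+-identityʳ m)

*-monoˡ : ∀ {p q s} → 0ℚ ≤ s → p ≤ q → s * p ≤ s * q
*-monoˡ {s = s} 0≤s = ℚP.*-monoˡ-≤-nonNeg s {{nonNegative 0≤s}}

*-monoʳ : ∀ {p q s} → 0ℚ ≤ s → p ≤ q → p * s ≤ q * s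
*-monoʳ {s = s} 0≤s = ℚP.*-monoʳ-≤-nonNeg s {{nonNegative 0≤s}}

0≤* : ∀ {p q} → 0ℚ ≤ p → 0ℚ ≤ q → 0ℚ ≤ p * q
0≤* {p} {q} 0≤p 0≤q = subst (_≤ p * q) (ℚP.*-zeroʳ p) (*-monoˡ 0≤p 0≤q)

0≤square : ∀ p → 0ℚ ≤ p * p
0≤square p with ℚP.≤-total 0ℚ p
... | inj₁ 0≤p = 0≤* 0≤p 0≤p
... | inj₂ p≤0 = subst (0ℚ ≤_) (solve 1 (λ p → (:- p) :* (:- p) := p :* p) refl p) (0≤* 0≤-p 0≤-p)
  where
  0≤-p : 0ℚ ≤ - p
  0≤-p = ℚP.neg-antimono-≤ p≤0

positive⇒0≤ : ∀ {p} → Positive p → 0ℚ ≤ p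
positive⇒0≤ {p} p>0 = ℚP.<⇒≤ (ℚP.positive⁻¹ p {{p>0}})

positive⇒≢0 : ∀ {p} → Positive p → p ≢ 0ℚ
positive⇒≢0 {p} p>0 p≡0 = ℚP.<-irrefl (sym p≡0) (ℚP.positive⁻¹ p {{p>0}})

⁻¹-inverse : ∀ {p} → Positive p → p * p ⁻¹ ≡ 1ℚ
⁻¹-inverse {p} p>0 = ⁻¹-inverseʳ {p} (positive⇒≢0 p>0)

0≤⁻¹ : ∀ {p} → Positive p → 0ℚ ≤ p ⁻¹
0≤⁻¹ {p} p>0 = positive⇒0≤ (⁻¹-positive p p>0)

-- The convention 0ℚ ⁻¹ = 0ℚ makes this true at zero as well, so `r-flip` holds for all terms, not
-- only for circuits.
⁻¹-involutive : ∀ p → p ⁻¹ ⁻¹ ≡ p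
⁻¹-involutive p = by-cases (p ℚ.≟ 0ℚ)
  where
  open ≡-Reasoning
  by-cases : Relation.Nullary.Dec (p ≡ 0ℚ) → p ⁻¹ ⁻¹ ≡ p
  by-cases (yes refl) = refl
  by-cases (no p≢0)   = begin
    p ⁻¹ ⁻¹                ≡⟨ ℚP.*-identityˡ (p ⁻¹ ⁻¹) ⟨
    1ℚ * p ⁻¹ ⁻¹           ≡⟨ cong (_* p ⁻¹ ⁻¹) (⁻¹-inverseʳ p≢0) ⟨
    p * p ⁻¹ * p ⁻¹ ⁻¹     ≡⟨ ℚP.*-assoc p (p ⁻¹) (p ⁻¹ ⁻¹) ⟩
    p * (p ⁻¹ * p ⁻¹ ⁻¹)   ≡⟨ cong (p *_) (⁻¹-inverseʳ p⁻¹≢0) ⟩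
    p * 1ℚ                 ≡⟨ ℚP.*-identityʳ p ⟩
    p                      ∎
    where
    p⁻¹≢0 : p ⁻¹ ≢ 0ℚ
    p⁻¹≢0 eq with trans (sym (⁻¹-inverseʳ p≢0)) (trans (cong (p *_) eq) (ℚP.*-zeroʳ p))
    ... | ()

1≤p⇒p⁻¹≤1 : ∀ {p} → 1ℚ ≤ p → p ⁻¹ ≤ 1ℚ
1≤p⇒p⁻¹≤1 {p} 1≤p = subst₂ _≤_ (ℚP.*-identityˡ (p ⁻¹)) (⁻¹-inverse {p} p>0) (*-monoʳ (0≤⁻¹ {p} p>0) 1≤p)
  where
  p>0 : Positive p
  p>0 = positive (ℚP.<-≤-trans (ℚP.positive⁻¹ 1ℚ) 1≤p)

-- From x * (1 - μ * y)² ≥ 0: x lies above its tangent as a convex function of y = 1 / x.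
tangent : ∀ {x y} → 0ℚ ≤ x → y * x ≡ 1ℚ → ∀ μ → ι 2 * μ ≤ x + μ * μ * y
tangent {x} {y} 0≤x yx≡1 μ = begin
  ι 2 * μ                                          ≡⟨ ℚP.+-identityʳ (ι 2 * μ) ⟨
  ι 2 * μ + 0ℚ
    ≤⟨ ℚP.+-monoʳ-≤ (ι 2 * μ) (0≤* 0≤x (0≤square (1ℚ - μ * y))) ⟩
  ι 2 * μ + x * ((1ℚ - μ * y) * (1ℚ - μ * y))      ≡⟨ solve 3 (λ x y m →
      (con 1ℚ :+ (con 1ℚ :+ con 0ℚ)) :* m :+ x :* ((con 1ℚ :- m :* y) :* (con 1ℚ :- m :* y)) :=
      x :+ (con 1ℚ :+ (con 1ℚ :+ con 0ℚ)) :* m :* (con 1ℚ :- y :* x) :+ m :* m :* y :* (y :* x)) refl x y μ ⟩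
  x + ι 2 * μ * (1ℚ - y * x) + μ * μ * y * (y * x)
    ≡⟨ cong (λ z → x + ι 2 * μ * (1ℚ - z) + μ * μ * y * z) yx≡1 ⟩
  x + ι 2 * μ * (1ℚ - 1ℚ) + μ * μ * y * 1ℚ
    ≡⟨ cong₂ _+_ (trans (cong (x +_) (ℚP.*-zeroʳ (ι 2 * μ))) (ℚP.+-identityʳ x)) (ℚP.*-identityʳ (μ * μ * y)) ⟩
  x + μ * μ * y                                    ∎
  where open ℚP.≤-Reasoning

∑-mono : ∀ {X : Set} {f h : X → ℚ} {xs} → All (λ x → f x ≤ h x) xs → ∑ xs f ≤ ∑ xs h
∑-mono []         = ℚP.≤-refl
∑-mono (le ∷ les) = ℚP.+-mono-≤ le (∑-mono les)

∑-const : ∀ {X : Set} q (xs : List X) → ∑ xs (const q) ≡ q * ι (length xs)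
∑-const q []       = sym (ℚP.*-zeroʳ q)
∑-const q (x ∷ xs) = begin
  q + ∑ xs (const q)           ≡⟨ cong₂ _+_ (sym (ℚP.*-identityʳ q)) (∑-const q xs) ⟩
  q * 1ℚ + q * ι (length xs)      ≡⟨ ℚP.*-distribˡ-+ q 1ℚ (ι (length xs)) ⟨
  q * ι (suc (length xs))         ∎
  where open ≡-Reasoning

0≤∑ : ∀ {X : Set} {f : X → ℚ} {xs} → All (λ x → 0ℚ ≤ f x) xs → 0ℚ ≤ ∑ xs f
0≤∑ []         = ℚP.≤-refl
0≤∑ (le ∷ les) = ℚP.+-mono-≤ le (0≤∑ les)

weight-1 : ∀ cs n → weight cs (const 1ℚ) n ≡ ι (count cs n)
weight-1 cs n = trans (∑-const 1ℚ (multisets cs n)) (trans (ℚP.*-identityˡ _) (cong ι (sym (∑-1 (multisets cs n)))))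

diagℚ-mono : ∀ N {F G : ℕ → ℕ → ℚ} → (∀ i j → i ℕ.+ j ≡ N → F i j ≤ G i j) → diag F N ≤ diag G N
diagℚ-mono zero    le = le 0 0 refl
diagℚ-mono (suc N) le = ℚP.+-mono-≤ (le 0 (suc N) refl) (diagℚ-mono N (λ i j eq → le (suc i) j (cong suc eq)))

ι-diag : ∀ N F → ι (ℕΣ.diag F N) ≡ diag (λ i j → ι (F i j)) N
ι-diag zero    F = refl
ι-diag (suc N) F = trans (ι-+ (F 0 (suc N)) _) (cong (ι (F 0 (suc N)) +_) (ι-diag N (F ∘ suc)))

-- Duality for resistances

ρ : Circuit → ℚ
ρ c = r c ⁻¹

resistances≡map : ∀ cs → resistances cs ≡ map r cs
resistances≡map []       = refl
resistances≡map (c ∷ cs) = cong (r c ∷_) (resistances≡map cs)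

mutual
  r-flip : ∀ c → r (flip c) ≡ ρ c
  r-flip unit               = refl
  r-flip (join series cs)   = cong _⁻¹ (trans (cong (sumℚ ∘ map _⁻¹) (resistances-flip cs))
    (cong sumℚ (trans (sym (ListP.map-∘ (resistances cs))) (trans (ListP.map-cong ⁻¹-involutive (resistances cs)) (ListP.map-id (resistances cs))))))
  r-flip (join parallel cs) = trans (cong sumℚ (resistances-flip cs)) (sym (⁻¹-involutive _))

  resistances-flip : ∀ cs → resistances (flips cs) ≡ map _⁻¹ (resistances cs)
  resistances-flip []       = refl
  resistances-flip (c ∷ cs) = cong₂ _∷_ (r-flip c) (resistances-flip cs)

r-series-flip : ∀ ds → r (join series (map flip ds)) ≡ ∑ ds ρ
r-series-flip ds = trans (cong sumℚ (resistances≡map (map flip ds)))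
  (trans (∑-map r flip ds) (∑-ext r-flip ds))

-- By `r-flip`, ρ is the resistance of the dual, so P n is the total resistance of the parallel
-- n-circuits.
S P : ℕ → ℚ
S n = ∑ (exactly series n) r
P n = ∑ (exactly series n) ρ

S-multisets : ∀ n → S (2 ℕ.+ n) ≡ ∑ (multisets (atMost series (suc n)) (2 ℕ.+ n)) (λ ds → ∑ ds ρ)
S-multisets n = trans (cong (λ l → ∑ l r) (exactly-series n))
  (trans (∑-map r _ multis) (∑-ext r-series-flip multis))
  where multis = multisets (atMost series (suc n)) (2 ℕ.+ n)

P-multisets : ∀ n → P (2 ℕ.+ n) ≡ ∑ (multisets (atMost series (suc n)) (2 ℕ.+ n)) (λ ds → ∑ ds ρ ⁻¹)
P-multisets n = trans (cong (λ l → ∑ l ρ) (exactly-series n))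
  (trans (∑-map ρ _ multis) (∑-ext (cong _⁻¹ ∘ r-series-flip) multis))
  where multis = multisets (atMost series (suc n)) (2 ℕ.+ n)

S-diag : ∀ n → S (2 ℕ.+ n) ≡ diag (λ i j → P (suc i) * ι (g (suc i) (suc j))) n
S-diag n = begin
  S (2 ℕ.+ n)
    ≡⟨ S-multisets n ⟩
  ∑ multis (λ ds → ∑ ds ρ)
    ≡⟨ ∑-ext (λ ds → sym (ℚP.*-identityˡ (∑ ds ρ))) multis ⟩
  marked (atMost series (suc n)) ρ (const 1ℚ) (2 ℕ.+ n)
    ≡⟨ marked-atMost series ρ (const 1ℚ) n ⟩
  diag (λ i j → P (suc i) * weight (line (suc i) ∷ atMost series (suc j)) (const 1ℚ) (suc j)) n
    ≡⟨ diag-cong n (λ i j _ → cong (P (suc i) *_) (weight-1 (line (suc i) ∷ atMost series (suc j)) (suc j))) ⟩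
  diag (λ i j → P (suc i) * ι (g (suc i) (suc j))) n ∎
  where
  open ≡-Reasoning
  multis = multisets (atMost series (suc n)) (2 ℕ.+ n)

-- The simultaneous bounds for series and parallel circuits

Bounds : ℕ → Set
Bounds n = S (suc n) ≤ ι (6 ℕ.* a (suc n)) × P (suc n) ≤ ι (2 ℕ.* a (suc n))

S-bound : ∀ n → (∀ i → i ℕ.≤ n → Bounds i) → S (2 ℕ.+ n) ≤ ι (6 ℕ.* a (2 ℕ.+ n))
S-bound n bounds = begin
  S (2 ℕ.+ n)
    ≡⟨ S-diag n ⟩
  diag (λ i j → P (suc i) * ι (g (suc i) (suc j))) n
    ≤⟨ diagℚ-mono n (λ i j eq → *-monoʳ (0≤ι (g (suc i) (suc j))) (P≤w i (subst (i ℕ.≤_) eq (ℕP.m≤m+n i j)))) ⟩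
  diag (λ i j → ι (w i) * ι (g (suc i) (suc j))) n
    ≡⟨ diag-cong n (λ i j _ → ι-* (w i) (g (suc i) (suc j))) ⟨
  diag (λ i j → ι (w i ℕ.* g (suc i) (suc j))) n
    ≡⟨ ι-diag n (λ i j → w i ℕ.* g (suc i) (suc j)) ⟨
  ι (ℕΣ.diag (λ i j → w i ℕ.* g (suc i) (suc j)) n)
    ≤⟨ ι-mono (diag-w-bound n) ⟩
  ι (6 ℕ.* a (2 ℕ.+ n)) ∎
  where
  open ℚP.≤-Reasoning
  P≤w : ∀ i → i ℕ.≤ n → P (suc i) ≤ ι (w i)
  -- The exact value P 1 = 1 is used, half of what `Bounds` would give.
  P≤w zero    _   = ℚP.≤-refl
  P≤w (suc i) i<n = proj₂ (bounds (suc i) i<n)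

-- With 1/(2k), in place of the 1/k² from AM-HM, k parts of average resistance at most 6 give the
-- constant 3.
ψ : ℕ → ℚ
ψ k = ι (2 ℕ.* k) ⁻¹

∑-positive : ∀ {f : Circuit → ℚ} {ds} → 1 ℕ.≤ length ds → All (λ d → Positive (f d)) ds → Positive (∑ ds f)
∑-positive {f} {ds} 1≤ds f>0 = sumℚ-positive (subst (1 ℕ.≤_) (sym (ListP.length-map f ds)) 1≤ds) (AllP.map⁺ f>0)

-- AM-HM, obtained by summing the tangents at μ = k / Y.
am-hm : ∀ {ds} → 2 ℕ.≤ length ds → All (λ d → Positive (r d)) ds →
  ∑ ds ρ ⁻¹ ≤ ψ (length ds) * ∑ ds r
am-hm {ds@(_ ∷ _)} 2≤ds r>0 = begin
  Y⁻¹                        ≡⟨ ℚP.*-identityˡ Y⁻¹ ⟨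
  1ℚ * Y⁻¹
    ≡⟨ cong (_* Y⁻¹) (trans (ℚP.*-comm (ψ k) (ι (2 ℕ.* k))) (⁻¹-inverse {ι (2 ℕ.* k)} (ι-positive (2 ℕ.* k)))) ⟨
  ψ k * ι (2 ℕ.* k) * Y⁻¹    ≡⟨ ℚP.*-assoc (ψ k) (ι (2 ℕ.* k)) Y⁻¹ ⟩
  ψ k * (ι (2 ℕ.* k) * Y⁻¹)  ≤⟨ *-monoˡ (0≤⁻¹ {ι (2 ℕ.* k)} (ι-positive (2 ℕ.* k))) 2kY⁻¹≤X ⟩
  ψ k * X                    ∎
  where
  open ℚP.≤-Reasoning
  k = length ds
  X = ∑ ds r
  Y = ∑ ds ρ
  Y⁻¹ = Y ⁻¹
  Y>0 : Positive Y
  Y>0 = ∑-positive {ρ} {ds} (s≤s z≤n) (All.map (λ {d} → ⁻¹-positive (r d)) r>0)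
  μ = ι k * Y⁻¹
  tangents : ι 2 * μ * ι k ≤ X + μ * μ * Y
  tangents = begin
    ι 2 * μ * ι k                          ≡⟨ ∑-const (ι 2 * μ) ds ⟨
    ∑ ds (const (ι 2 * μ))
      ≤⟨ ∑-mono (All.map (λ {d} r>0 → tangent {r d} {ρ d} (positive⇒0≤ r>0)
                                                (trans (ℚP.*-comm (ρ d) (r d)) (⁻¹-inverse {r d} r>0)) μ) r>0) ⟩
    ∑ ds (λ d → r d + μ * μ * ρ d)      ≡⟨ ∑-distrib-+ r (λ d → μ * μ * ρ d) ds ⟩
    X + ∑ ds (λ d → μ * μ * ρ d)        ≡⟨ cong (X +_) (∑-*ˡ (μ * μ) ρ ds) ⟩
    X + μ * μ * Y                          ∎
  k²Y⁻¹≤X : ι k * μ ≤ X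
  k²Y⁻¹≤X = begin
    ι k * μ
      ≡⟨ solve 2 (λ k z → k :* (k :* z) := (con 1ℚ :+ (con 1ℚ :+ con 0ℚ)) :* (k :* z) :* k :+ :- (k :* z :* k)) refl (ι k) Y⁻¹ ⟩
    ι 2 * μ * ι k + - (μ * ι k)
      ≤⟨ ℚP.+-monoˡ-≤ (- (μ * ι k)) tangents ⟩
    X + μ * μ * Y + - (μ * ι k)
      ≡⟨ solve 4 (λ x k z y → x :+ k :* z :* (k :* z) :* y :+ :- (k :* z :* k) := x :+ k :* z :* k :* (y :* z :+ :- con 1ℚ)) refl X (ι k) Y⁻¹ Y ⟩
    X + μ * ι k * (Y * Y⁻¹ + - 1ℚ)
      ≡⟨ cong (λ z → X + μ * ι k * (z + - 1ℚ)) (⁻¹-inverse {Y} Y>0) ⟩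
    X + μ * ι k * 0ℚ
      ≡⟨ trans (cong (X +_) (ℚP.*-zeroʳ (μ * ι k))) (ℚP.+-identityʳ X) ⟩
    X ∎
  2kY⁻¹≤X : ι (2 ℕ.* k) * Y⁻¹ ≤ X
  2kY⁻¹≤X = begin
    -- Here k ≥ 2 is used, in the form 2 k ≤ k².
    ι (2 ℕ.* k) * Y⁻¹   ≤⟨ *-monoʳ (0≤⁻¹ {Y} Y>0) (ι-mono (ℕP.*-monoˡ-≤ k 2≤ds)) ⟩
    ι (k ℕ.* k) * Y⁻¹   ≡⟨ trans (cong (_* Y⁻¹) (ι-* k k)) (ℚP.*-assoc (ι k) (ι k) Y⁻¹) ⟩
    ι k * μ             ≤⟨ k²Y⁻¹≤X ⟩
    X                   ∎

nonunits-sound : ∀ n → All (λ c → Is series c × size c ℕ.≤ suc n) (nonunits series n)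
nonunits-sound n = All.tail (subst (All _) (atMost-unit series n) (atMost-sound series (suc n)))

-- A single resistance may exceed 6. But circuits of equal size share the factor X, so the bound for
-- their total resistance suffices.
∑-nonunits-≤ : ∀ n {X : ℕ → ℚ} → (∀ d → 0ℚ ≤ X d) → (∀ i → i ℕ.≤ n → Bounds i) →
  ∑ (nonunits series n) (λ c → r c * X (size c)) ≤ ∑ (nonunits series n) (λ c → ι 6 * X (size c))
∑-nonunits-≤ zero    0≤X bounds = ℚP.≤-refl
∑-nonunits-≤ (suc n) {X} 0≤X bounds = begin
  ∑ (nu ++ ex) (λ c → r c * X (size c))
    ≡⟨ ∑-++ (λ c → r c * X (size c)) nu ex ⟩
  ∑ nu (λ c → r c * X (size c)) + ∑ ex (λ c → r c * X (size c))
    ≡⟨ cong (∑ nu (λ c → r c * X (size c)) +_) (∑-exactly series (2 ℕ.+ n) r X) ⟩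
  ∑ nu (λ c → r c * X (size c)) + S (2 ℕ.+ n) * X (2 ℕ.+ n)
    ≤⟨ ℚP.+-mono-≤ (∑-nonunits-≤ n {X} 0≤X (λ i i≤n → bounds i (ℕP.m≤n⇒m≤1+n i≤n)))
         (*-monoʳ (0≤X (2 ℕ.+ n)) (proj₁ (bounds (suc n) ℕP.≤-refl))) ⟩
  ∑ nu (λ c → ι 6 * X (size c)) + ι (6 ℕ.* a (2 ℕ.+ n)) * X (2 ℕ.+ n)
    ≡⟨ cong (λ z → ∑ nu (λ c → ι 6 * X (size c)) + z * X (2 ℕ.+ n)) (trans (ι-* 6 (a (2 ℕ.+ n))) (sym (∑-const (ι 6) ex))) ⟩
  ∑ nu (λ c → ι 6 * X (size c)) + ∑ ex (const (ι 6)) * X (2 ℕ.+ n)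
    ≡⟨ cong (∑ nu (λ c → ι 6 * X (size c)) +_) (∑-exactly series (2 ℕ.+ n) (const (ι 6)) X) ⟨
  ∑ nu (λ c → ι 6 * X (size c)) + ∑ ex (λ c → ι 6 * X (size c))
    ≡⟨ ∑-++ (λ c → ι 6 * X (size c)) nu ex ⟨
  ∑ (nu ++ ex) (λ c → ι 6 * X (size c)) ∎
  where
  open ℚP.≤-Reasoning
  nu = nonunits series n
  ex = exactly series (2 ℕ.+ n)

0≤shift : ∀ s {u} → (∀ m → 0ℚ ≤ u m) → ∀ n → 0ℚ ≤ shift s u n
0≤shift zero    0≤u n       = 0≤u n
0≤shift (suc s) 0≤u zero    = ℚP.≤-refl
0≤shift (suc s) 0≤u (suc n) = 0≤shift s 0≤u n

-- By `marked-sum` and `weight-size` the cofactor of r c depends on the size of c only, which allows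
-- averaging within each size.
marked-nonunits-≤ : ∀ n {φ} → (∀ k → 0ℚ ≤ φ k) → (∀ i → i ℕ.≤ n → Bounds i) → ∀ m →
  marked (nonunits series n) r φ m ≤ marked (nonunits series n) (const (ι 6)) φ m
marked-nonunits-≤ n {φ} 0≤φ bounds m = begin
  marked nu r φ m                      ≡⟨ by-size r ⟩
  ∑ nu (λ c → r c * X (size c))        ≤⟨ ∑-nonunits-≤ n {X} 0≤X bounds ⟩
  ∑ nu (λ c → ι 6 * X (size c))        ≡⟨ by-size (const (ι 6)) ⟨
  marked nu (const (ι 6)) φ m          ∎
  where
  open ℚP.≤-Reasoning
  nu = nonunits series n
  1≤nu : All (λ c → 1 ℕ.≤ size c) nu
  1≤nu = All.map (1≤size ∘ proj₁) (nonunits-sound n)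
  X : ℕ → ℚ
  X d = shift d (weight (line d ∷ nu) (φ ∘ suc)) m
  0≤X : ∀ d → 0ℚ ≤ X d
  0≤X d = 0≤shift d (λ m → 0≤∑ (All.universal (λ ds → 0≤φ (suc (length ds))) (multisets (line d ∷ nu) m))) m
  by-size : ∀ f → marked nu f φ m ≡ ∑ nu (λ c → f c * X (size c))
  by-size f = trans (marked-sum 1≤nu f φ m)
    (∑-cong (All.map (λ {c} 1≤c → cong (f c *_) (shift-ext (size c)
      (weight-size c (line (size c)) nu 1≤c (sym (size-line (size c))) (φ ∘ suc)) m)) 1≤nu))

0≤ψ : ∀ k → 0ℚ ≤ ψ k
0≤ψ zero    = ℚP.≤-refl
0≤ψ (suc k) = 0≤⁻¹ {ι (2 ℕ.* suc k)} (ι-positive (2 ℕ.* suc k))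

ψ-6 : ∀ {k} → 1 ℕ.≤ k → ψ k * (ι 6 * ι k) ≡ ι 3
ψ-6 {k@(suc _)} _ = begin
  ψ k * (ι 6 * ι k)
    ≡⟨ cong (ψ k *_) (trans (sym (ι-* 6 k)) (trans (cong ι (ℕP.*-assoc 3 2 k)) (ι-* 3 (2 ℕ.* k)))) ⟩
  ψ k * (ι 3 * ι (2 ℕ.* k))
    ≡⟨ solve 3 (λ x y z → x :* (y :* z) := y :* (z :* x)) refl (ψ k) (ι 3) (ι (2 ℕ.* k)) ⟩
  ι 3 * (ι (2 ℕ.* k) * ψ k)    ≡⟨ cong (ι 3 *_) (⁻¹-inverse {ι (2 ℕ.* k)} (ι-positive (2 ℕ.* k))) ⟩
  ι 3 * 1ℚ                     ≡⟨ ℚP.*-identityʳ (ι 3) ⟩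
  ι 3                          ∎
  where open ≡-Reasoning

nonunit-bound : ∀ n → (∀ i → i ℕ.≤ n → Bounds i) →
  ∑ (multisets (nonunits series n) (2 ℕ.+ n)) (λ ds → ∑ ds ρ ⁻¹) ≤ ι (3 ℕ.* count (nonunits series n) (2 ℕ.+ n))
nonunit-bound n bounds = begin
  ∑ multis (λ ds → ∑ ds ρ ⁻¹)
    ≤⟨ ∑-mono (All.map (λ {ds} (ps , eq) → am-hm (2≤length ds (All.map proj₂ ps) eq) (All.map (r-positive ∘ proj₁) ps)) sound) ⟩
  marked nu r ψ (2 ℕ.+ n)
    ≤⟨ marked-nonunits-≤ n 0≤ψ bounds (2 ℕ.+ n) ⟩
  marked nu (const (ι 6)) ψ (2 ℕ.+ n)
    ≡⟨ ∑-cong (All.map (λ {ds} (ps , eq) → trans (cong (ψ (length ds) *_) (∑-const (ι 6) ds))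
         (ψ-6 (ℕP.≤-trans (s≤s z≤n) (2≤length ds (All.map proj₂ ps) eq)))) sound) ⟩
  ∑ multis (const (ι 3))
    ≡⟨ ∑-const (ι 3) multis ⟩
  ι 3 * ι (length multis)
    ≡⟨ trans (cong (λ z → ι 3 * ι z) (sym (∑-1 multis))) (sym (ι-* 3 (count nu (2 ℕ.+ n)))) ⟩
  ι (3 ℕ.* count nu (2 ℕ.+ n)) ∎
  where
  open ℚP.≤-Reasoning
  nu = nonunits series n
  multis = multisets nu (2 ℕ.+ n)
  sound = multisets-sound (nonunits-sound n) (2 ℕ.+ n)

-- A unit part in parallel contributes 1 to the sum of the inverses, so the resistance is at most 1.
unit-bound : ∀ n → ∑ (multisets (atMost series (suc n)) (suc n)) (λ ds → ∑ (unit ∷ ds) ρ ⁻¹) ≤ ι (e (suc n))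
unit-bound n = begin
  ∑ multis (λ ds → ∑ (unit ∷ ds) ρ ⁻¹)
    ≤⟨ ∑-mono (All.map (λ {ds} (ps , _) → 1≤p⇒p⁻¹≤1 (at-least-1 ds (All.map proj₁ ps)))
                                                  (multisets-sound (atMost-sound series (suc n)) (suc n))) ⟩
  ∑ multis (const 1ℚ)                        ≡⟨ weight-1 (atMost series (suc n)) (suc n) ⟩
  ι (e (suc n))                                 ∎
  where
  open ℚP.≤-Reasoning
  multis = multisets (atMost series (suc n)) (suc n)
  at-least-1 : ∀ ds → All (Is series) ds → 1ℚ ≤ 1ℚ + ∑ ds ρ
  at-least-1 ds is = subst (_≤ 1ℚ + ∑ ds ρ) (ℚP.+-identityʳ 1ℚ)
    (ℚP.+-monoʳ-≤ 1ℚ (0≤∑ (All.map (λ {d} i → 0≤⁻¹ {r d} (r-positive i)) is)))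

-- Circuits without a unit part are bounded by 3 each, the others by 1. As h + e = a by `a-split`,
-- the total 3 h + e equals 3 a - 2 e, which is at most 2 a because a ≤ 2 e.
P-bound : ∀ n → (∀ i → i ℕ.≤ n → Bounds i) → P (2 ℕ.+ n) ≤ ι (2 ℕ.* a (2 ℕ.+ n))
P-bound n bounds = begin
  P (2 ℕ.+ n)
    ≡⟨ P-multisets n ⟩
  ∑ (multisets (atMost series (suc n)) (2 ℕ.+ n)) F
    ≡⟨ cong (λ cs → ∑ (multisets cs (2 ℕ.+ n)) F) (atMost-unit series n) ⟩
  ∑ (multisets (unit ∷ nu) (2 ℕ.+ n)) F
    ≡⟨ ∑-multisets unit nu (s≤s z≤n) F (2 ℕ.+ n) ⟩
  ∑ (multisets nu (2 ℕ.+ n)) F + ∑ (multisets (unit ∷ nu) (suc n)) (λ ds → F (unit ∷ ds))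
    ≡⟨ cong (λ cs → ∑ (multisets nu (2 ℕ.+ n)) F + ∑ (multisets cs (suc n)) (λ ds → F (unit ∷ ds))) (atMost-unit series n) ⟨
  ∑ (multisets nu (2 ℕ.+ n)) F + ∑ (multisets (atMost series (suc n)) (suc n)) (λ ds → F (unit ∷ ds))
    ≤⟨ ℚP.+-mono-≤ (nonunit-bound n bounds) (unit-bound n) ⟩
  ι (3 ℕ.* h) + ι (e (suc n))
    ≡⟨ ι-+ (3 ℕ.* h) (e (suc n)) ⟨
  ι (3 ℕ.* h ℕ.+ e (suc n))
    ≤⟨ ι-mono numeric ⟩
  ι (2 ℕ.* a (2 ℕ.+ n)) ∎
  where
  open ℚP.≤-Reasoning
  nu = nonunits series n
  h = count nu (2 ℕ.+ n)
  F : List Circuit → ℚ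
  F ds = ∑ ds ρ ⁻¹
  -- From size 2 on e is 2 a, and this becomes `a-quadruple`; size 1 is separate because e 1 = a 1.
  a≤2e : ∀ n → a (2 ℕ.+ n) ℕ.≤ 2 ℕ.* e (suc n)
  a≤2e zero    = ℕP.m≤m+n 1 1
  a≤2e (suc n) =
    ℕP.≤-trans (a-quadruple (suc n)) (ℕP.≤-reflexive (trans (ℕP.*-assoc 2 2 (a (2 ℕ.+ n))) (cong (2 ℕ.*_) (sym (e≡2a n)))))
  numeric : 3 ℕ.* h ℕ.+ e (suc n) ℕ.≤ 2 ℕ.* a (2 ℕ.+ n)
  numeric = ℕP.+-cancelʳ-≤ (a (2 ℕ.+ n)) _ _ (ℕP.≤-trans
    (ℕP.+-monoʳ-≤ (3 ℕ.* h ℕ.+ e (suc n)) (a≤2e n))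
    (ℕP.≤-reflexive (trans (collect h (e (suc n))) (trans (cong (3 ℕ.*_) (sym (a-split n))) (triple (a (2 ℕ.+ n)))))))
    where
    collect : ∀ h e → 3 ℕ.* h ℕ.+ e ℕ.+ 2 ℕ.* e ≡ 3 ℕ.* (h ℕ.+ e)
    collect = solve-∀
    triple : ∀ x → 3 ℕ.* x ≡ 2 ℕ.* x ℕ.+ x
    triple = solve-∀

bounds : ∀ n → Bounds n
bounds = <-rec Bounds step
  where
  step : ∀ n → (∀ {i} → i ℕ.< n → Bounds i) → Bounds n
  step zero    _   = ι-mono {1} {6} (s≤s z≤n) , ι-mono {1} {2} (s≤s z≤n)
  step (suc n) rec = S-bound n (λ i i≤n → rec (s≤s i≤n)) , P-bound n (λ i i≤n → rec (s≤s i≤n))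

-- The average resistance

Q≡2a : ∀ n → Q (2 ℕ.+ n) ≡ a (2 ℕ.+ n) ℕ.+ a (2 ℕ.+ n)
Q≡2a n = trans (ListP.length-++ (exactly series (2 ℕ.+ n)))
  (cong (a (2 ℕ.+ n) ℕ.+_) (trans (cong length (exactly-flip series (2 ℕ.+ n))) (ListP.length-map flip (exactly series (2 ℕ.+ n)))))

R≡S+P : ∀ n → R (2 ℕ.+ n) ≡ S (2 ℕ.+ n) + P (2 ℕ.+ n)
R≡S+P n = begin
  ∑ (ex ++ exactly parallel (2 ℕ.+ n)) r
    ≡⟨ cong (λ l → ∑ (ex ++ l) r) (exactly-flip series (2 ℕ.+ n)) ⟩
  ∑ (ex ++ map flip ex) r                        ≡⟨ ∑-++ r ex (map flip ex) ⟩
  S (2 ℕ.+ n) + ∑ (map flip ex) r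
    ≡⟨ cong (S (2 ℕ.+ n) +_) (trans (∑-map r flip ex) (∑-ext r-flip ex)) ⟩
  S (2 ℕ.+ n) + P (2 ℕ.+ n)                         ∎
  where
  open ≡-Reasoning
  ex = exactly series (2 ℕ.+ n)

-- A series circuit and its dual together contribute r + 1/r, which is at least 2 by `tangent` at μ
-- = 1.
Q≤R : ∀ n → ι (Q (suc n)) ≤ R (suc n)
Q≤R zero    = ℚP.≤-refl
Q≤R (suc n) = begin
  ι (Q (2 ℕ.+ n))
    ≡⟨ cong ι (trans (Q≡2a n) (cong (a (2 ℕ.+ n) ℕ.+_) (sym (ℕP.+-identityʳ (a (2 ℕ.+ n)))))) ⟩
  ι (2 ℕ.* a (2 ℕ.+ n))                ≡⟨ ι-* 2 (a (2 ℕ.+ n)) ⟩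
  ι 2 * ι (a (2 ℕ.+ n))                ≡⟨ ∑-const (ι 2) ex ⟨
  ∑ ex (const (ι 2))
    ≤⟨ ∑-mono (All.map (λ {c} (i , _) → r+ρ {c} (r-positive i)) (exactly-sound series (2 ℕ.+ n))) ⟩
  ∑ ex (λ c → r c + ρ c)            ≡⟨ ∑-distrib-+ r ρ ex ⟩
  S (2 ℕ.+ n) + P (2 ℕ.+ n)            ≡⟨ R≡S+P n ⟨
  R (2 ℕ.+ n)                          ∎
  where
  open ℚP.≤-Reasoning
  ex = exactly series (2 ℕ.+ n)
  r+ρ : ∀ {c} → Positive (r c) → ι 2 ≤ r c + ρ c
  r+ρ {c} r>0 = subst₂ _≤_ (ℚP.*-identityʳ (ι 2)) (cong (r c +_) (ℚP.*-identityˡ (ρ c)))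
    (tangent {r c} {ρ c} (positive⇒0≤ r>0) (trans (ℚP.*-comm (ρ c) (r c)) (⁻¹-inverse {r c} r>0)) 1ℚ)

R≤4Q : ∀ n → R (suc n) ≤ ι 4 * ι (Q (suc n))
R≤4Q zero    = toWitness {a? = R 1 ℚ.≤? ι 4 * ι 1} _
R≤4Q (suc n) = begin
  R (2 ℕ.+ n)                          ≡⟨ R≡S+P n ⟩
  S (2 ℕ.+ n) + P (2 ℕ.+ n)            ≤⟨ ℚP.+-mono-≤ (proj₁ (bounds (suc n))) (proj₂ (bounds (suc n))) ⟩
  ι (6 ℕ.* x) + ι (2 ℕ.* x)            ≡⟨ ι-+ (6 ℕ.* x) (2 ℕ.* x) ⟨
  ι (6 ℕ.* x ℕ.+ 2 ℕ.* x)              ≡⟨ cong ι (trans (collect x) (cong (4 ℕ.*_) (sym (Q≡2a n)))) ⟩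
  ι (4 ℕ.* Q (2 ℕ.+ n))                ≡⟨ ι-* 4 (Q (2 ℕ.+ n)) ⟩
  ι 4 * ι (Q (2 ℕ.+ n))                ∎
  where
  open ℚP.≤-Reasoning
  x = a (2 ℕ.+ n)
  collect : ∀ x → 6 ℕ.* x ℕ.+ 2 ℕ.* x ≡ 4 ℕ.* (x ℕ.+ x)
  collect = solve-∀

open import Data.Integer using (+_)

mainTheorem2 : (n : ℕ) → .{{_ : NonZero n}} → 1ℚ ≤ M n × M n < + 43954 / 10000
mainTheorem2 n@(suc m) = lower , ℚP.≤-<-trans upper (toWitness {a? = ι 4 ℚ.<? (+ 43954 / 10000)} _)
  where
  instance
    Q≢0 : NonZero (Q n)
    Q≢0 = Q-nonZero n
  open ℚP.≤-Reasoning
  q : ℚ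
  q = + 1 / Q n
  0≤q : 0ℚ ≤ q
  0≤q = ℚP.nonNegative⁻¹ q {{ℚP.normalize-nonNeg 1 (Q n)}}
  lower : 1ℚ ≤ M n
  lower = begin
    1ℚ            ≡⟨ ι-/ (Q n) ⟨
    ι (Q n) * q   ≤⟨ *-monoʳ 0≤q (Q≤R m) ⟩
    R n * q       ∎
  upper : M n ≤ ι 4
  upper = begin
    R n * q               ≤⟨ *-monoʳ 0≤q (R≤4Q m) ⟩
    ι 4 * ι (Q n) * q     ≡⟨ ℚP.*-assoc (ι 4) (ι (Q n)) q ⟩
    ι 4 * (ι (Q n) * q)   ≡⟨ cong (ι 4 *_) (ι-/ (Q n)) ⟩
    ι 4 * 1ℚ              ≡⟨ ℚP.*-identityʳ (ι 4) ⟩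
    ι 4                   ∎
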